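{- Let $m\ge 4$ be even, $n=2^m-1$, and let $i_1\neq i_2$ in $\{0,1,2,3\}$ be such that the extended code $\mathcal{C}^*_{i_1,i_2}$ of $\mathcal{C}_{i_1,i_2}$ is an $[n+1,n-m-1,4]$ code of length $n+1=2^m$. Then $\mathcal{C}^*_{i_1,i_2}$ is completely transitive with covering radius $\rho=4$ and intersection array $\bigl(n+1,n,\tfrac{n+1}{2},1;\,1,\tfrac{n+1}{2},n,n+1\bigr)$ if and only if $0\notin\{i_1,i_2\}$.
   Context: $\mathbb{F}_2$ is the binary field. Let $\alpha$ be a primitive element of $GF(2^m)$ and let $H_m$ be the $m\times n$ binary matrix whose $i$-th column $\mathbf{h}_i$ ($i=0,\dots,n-1$) is the coordinate vector of $\alpha^i$ with respect to the basis $1,\alpha,\dots,\alpha^{m-1}$ (so the columns are exactly the nonzero vectors of $\mathbb{F}_2^m$; $H_m$ is a parity check matrix of the Hamming code). For distinct $i_1,i_2\in\{0,1,2,3\}$, $\mathbf{v}_{i_1,i_2}=(v_0,\dots,v_{n-1})$ has $v_i=1$ iff the Hamming weight $\mathrm{wt}(\mathbf{h}_i)\equiv i_1$ or $i_2\pmod 4$; $\mathcal{C}_{i_1,i_2}$ is the code with parity check matrix $H_m$ with the row $\mathbf{v}_{i_1,i_2}$ appended. The extension of a code $C$ of length $n$ is $C^*=\{(c_\infty,c_0,\dots,c_{n-1}):(c_0,\dots,c_{n-1})\in C,\ c_\infty=\sum_i c_i\}$. For a binary linear code $C$ of length $N$: $d(\mathbf{v},C)$ is the minimum Hamming distance from $\mathbf{v}$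 to $C$, the covering radius is $\rho=\max_{\mathbf{v}}d(\mathbf{v},C)$, and $C(l)=\{\mathbf{x}:d(\mathbf{x},C)=l\}$. $C$ is completely regular if for each $l$ every $\mathbf{x}\in C(l)$ has the same number $c_l$ of neighbors (vectors at distance 1) in $C(l-1)$ and the same number $b_l$ in $C(l+1)$; the intersection array is $(b_0,\dots,b_{\rho-1};c_1,\dots,c_\rho)$. $\mathrm{Aut}(C)$ is the group of coordinate permutations preserving $C$, acting on cosets via $\pi(C+\mathbf{v})=C+\pi(\mathbf{v})$; $C$ is completely transitive if $\mathrm{Aut}(C)$ has exactly $\rho+1$ orbits on the cosets of $C$. -}

module Defs where

open import Data.Bool using (Bool; true; false; _∧_; _∨_; _xor_; if_then_else_; not)
open import Data.Nat using (ℕ; zero; suc; _+_; _∸_; _^_; _⊓_; _⊔_; _%_; _≡ᵇ_; _<_; _≤_)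
open import Data.Fin using (Fin; toℕ)
open import Data.Fin.Permutation using (Permutation′; _⟨$⟩ʳ_)
open import Data.Vec using (Vec; []; _∷_; lookup; tabulate; zipWith; foldr; replicate)
open import Data.List as L using (List)
open import Data.Product using (Σ; ∃; _×_; _,_)
open import Relation.Binary.PropositionalEquality using (_≡_; _≢_)
open import Relation.Nullary.Decidable.Core using (does)
import Data.Fin as F

Word : ℕ → Set
Word N = Vec Bool N

Code : ℕ → Set
Code N = Word N → Bool

wt : ∀ {N} → Word N → ℕ
wt = foldr _ (λ b k → (if b then 1 else 0) + k) 0

_⊕_ : ∀ {N} → Word N → Word N → Word N
_⊕_ = zipWith _xor_

dist : ∀ {N} → Word N → Word N → ℕ
dist x y = wt (x ⊕ y)

parity : ∀ {N} → Word N → Bool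
parity = foldr _ _xor_ false

dot : ∀ {N} → Word N → Word N → Bool
dot x y = parity (zipWith _∧_ x y)

allWords : (N : ℕ) → List (Word N)
allWords zero = [] L.∷ L.[]
allWords (suc N) = L.map (false ∷_) (allWords N) L.++ L.map (true ∷_) (allWords N)

codewords : ∀ {N} → Code N → List (Word N)
codewords {N} C = L.filterᵇ C (allWords N)

size : ∀ {N} → Code N → ℕ
size C = L.length (codewords C)

-- C is a code with minimum distance d (minimum weight of a nonzero codeword,
-- the code being linear).
MinDist : ∀ {N} → Code N → ℕ → Set
MinDist C d =
  (Σ (Word _) λ c → C c ≡ true × wt c ≡ d) ×
  (∀ c → C c ≡ true → wt c ≢ 0 → d ≤ wt c)

-- d(x, C) = min over codewords c of dist(x,c)   (N is the default value,
-- never attained strictly since every code considered contains 0).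
dC : ∀ {N} → Code N → Word N → ℕ
dC {N} C x = L.foldr _⊓_ N (L.map (dist x) (codewords C))

coveringRadius : ∀ {N} → Code N → ℕ
coveringRadius {N} C = L.foldr _⊔_ 0 (L.map (dC C) (allWords N))

flipAt : ∀ {N} → Word N → Fin N → Word N
flipAt x i = x ⊕ tabulate (λ j → does (i F.≟ j))

neighboursAt : ∀ {N} → Code N → Word N → ℕ → ℕ
neighboursAt {N} C x l =
  L.length (L.filterᵇ (λ i → dC C (flipAt x i) ≡ᵇ l) (L.allFin N))

-- C is completely regular with intersection array
-- (b₀,…,b_{ρ-1}; c₁,…,c_ρ), where bs = (b₀,…,b_{ρ-1}) and
-- cs = (c₁,…,c_ρ) (so lookup cs j = c_{j+1}):
-- the covering radius is ρ, every x ∈ C(l), l < ρ, has exactly b_l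
-- neighbours in C(l+1), and every x ∈ C(l), 1 ≤ l ≤ ρ, has exactly c_l
-- neighbours in C(l-1).
HasIntersectionArray : ∀ {N} → Code N → (ρ : ℕ) → Vec ℕ ρ → Vec ℕ ρ → Set
HasIntersectionArray {N} C ρ bs cs =
  coveringRadius C ≡ ρ ×
  (∀ (x : Word N) (j : Fin ρ) → dC C x ≡ toℕ j →
     neighboursAt C x (suc (toℕ j)) ≡ lookup bs j) ×
  (∀ (x : Word N) (j : Fin ρ) → dC C x ≡ suc (toℕ j) →
     neighboursAt C x (toℕ j) ≡ lookup cs j)

act : ∀ {N} → Permutation′ N → Word N → Word N
act π v = tabulate (λ i → lookup v (π ⟨$⟩ʳ i))

IsAut : ∀ {N} → Code N → Permutation′ N → Set
IsAut C π = ∀ c → C c ≡ true → C (act π c) ≡ true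

SameCoset : ∀ {N} → Code N → Word N → Word N → Set
SameCoset C u v = C (u ⊕ v) ≡ true

HasOrbitCount : ∀ {N} → Code N → ℕ → Set
HasOrbitCount {N} C k =
  Σ (Vec (Word N) k) λ r →
    (∀ (x : Word N) → Σ (Fin k) λ j → Σ (Permutation′ N) λ π →
        IsAut C π × SameCoset C (act π (lookup r j)) x) ×
    (∀ (j j′ : Fin k) (π : Permutation′ N) → IsAut C π →
        SameCoset C (act π (lookup r j)) (lookup r j′) → j ≡ j′)

CompletelyTransitive : ∀ {N} → Code N → Set
CompletelyTransitive C = HasOrbitCount C (suc (coveringRadius C))

-- The field GF(2^m) = F₂[x]/(p), p monic of degree m,
-- p(x) = x^m + p_{m-1} x^{m-1} + … + p₀, given by pc = (p₀,…,p_{m-1}).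
-- Elements are coordinate vectors w.r.t. 1, α, …, α^{m-1}, where α = x mod p.

shiftIn : ∀ {m} → Bool → Vec Bool m → Vec Bool m × Bool
shiftIn c [] = [] , c
shiftIn c (b ∷ bs) with shiftIn b bs
... | r , o = (c ∷ r) , o

mulα : ∀ {m} → Vec Bool m → Vec Bool m → Vec Bool m
mulα pc v with shiftIn false v
... | r , true  = r ⊕ pc
... | r , false = r

one : ∀ {m} → Vec Bool m
one {zero} = []
one {suc m} = true ∷ replicate m false

powα : ∀ {m} → Vec Bool m → ℕ → Vec Bool m
powα pc zero = one
powα pc (suc i) = mulα pc (powα pc i)

len : ℕ → ℕ
len m = 2 ^ m ∸ 1

IsPrimitive : (m : ℕ) → Vec Bool m → Set
IsPrimitive m pc = ∀ (i j : Fin (len m)) → powα pc (toℕ i) ≡ powα pc (toℕ j) → i ≡ j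

hcol : ∀ {m} → Vec Bool m → Fin (len m) → Vec Bool m
hcol pc i = powα pc (toℕ i)

vrow : ∀ {m} → Vec Bool m → Fin 4 → Fin 4 → Word (len m)
vrow pc i₁ i₂ = tabulate λ i →
  ((wt (hcol pc i) % 4) ≡ᵇ toℕ i₁) ∨ ((wt (hcol pc i) % 4) ≡ᵇ toℕ i₂)

Hrow : ∀ {m} → Vec Bool m → Fin m → Word (len m)
Hrow pc k = tabulate λ i → lookup (hcol pc i) k

allRows : ∀ {m} → Vec Bool m → Word (len m) → Bool
allRows {m} pc c = L.foldr _∧_ true (L.map (λ k → not (dot (Hrow pc k) c)) (L.allFin m))

Cᵢ : ∀ {m} → Vec Bool m → Fin 4 → Fin 4 → Code (len m)
Cᵢ pc i₁ i₂ c = allRows pc c ∧ not (dot (vrow pc i₁ i₂) c)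

extend : ∀ {N} → Code N → Code (suc N)
extend C (c∞ ∷ c) = C c ∧ not (c∞ xor parity c)

{-# OPTIONS --safe #-}
-- Identify the coordinate ∞ with 0 and the coordinate i with α^i, so that
-- coordinates are the vectors u of F₂^m and the parity check matrix has columns
-- (1, f(u), u).  The binary digits of wt(u) mod 4 are the parity s₁ and the second
-- elementary symmetric polynomial e₂, and the indicator of two residue classes is
-- c + l s₁ + μ e₂, where c = 1 exactly if 0 ∈ {i₁, i₂}.  For m even the polar form
-- ⟪u, v⟫ = s₁(u) s₁(v) + u·v of e₂ is nondegenerate.
--
-- If c = 0 and μ = 0, then f is linear and the code has too many words.  If c = 0
-- and μ = 1, then f is bent: the distance of a coset is read off its syndrome, the
-- number of neighbours is a count over a hyperplane, and translations together
-- with symplectic transvections are automorphisms moving cosets of equal distance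
-- to each other.  If c = 1, then f(0) = 0 differs from the value of c + l s₁ + μ e₂ at 0,
-- and the word supported on {0, s} has 2 or 2 + 2^(m-1) neighbours at distance 1
-- from the code instead of 2^(m-1).
module Submission where

open import Defs
open import Algebra.Bundles using (CommutativeMonoid)
import Algebra.Properties.CommutativeMonoid.Sum as Sum
import Algebra.Properties.CommutativeSemigroup as CommutativeSemigroupProperties
open import Data.Bool using (Bool; true; false; _∧_; _∨_; _xor_; if_then_else_; not)
import Data.Bool as B
open import Data.Bool.Properties using (xor-assoc; xor-comm; xor-identityˡ; xor-identityʳ; xor-same; xor-inverseˡ; xor-inverseʳ; T?; T-≡; ∧-comm; ∧-zeroʳ; ∨-zeroʳ; ¬-not)
import Data.Bool.Solver as BoolSolver
open import Data.Empty using (⊥)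
open import Data.Fin using (Fin; zero; suc; toℕ)
import Data.Fin as F
open import Data.Fin.Permutation using (Permutation′; _⟨$⟩ʳ_; _⟨$⟩ˡ_; inverseˡ; inverseʳ; flip; permutation; _∘ₚ_)
import Data.Fin.Permutation as Perm
open import Data.Fin.Properties using (pigeonhole; combine-injective; toℕ<n; toℕ-fromℕ; toℕ-fromℕ<; toℕ-injective; punchInᵢ≢i; all?)
import Data.List as L
open import Data.List.Membership.Propositional using (_∈_; lose)
open import Data.List.Membership.Propositional.Properties using (∈-map⁺; ∈-map⁻; ∈-++⁺ˡ; ∈-++⁺ʳ; ∈-filter⁺; ∈-filter⁻; foldr-selective)
open import Data.List.Properties using (foldr-preservesᵒ; foldr-preservesᵇ; filter-++; length-++)
import Data.List.Relation.Unary.All as All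
import Data.List.Relation.Unary.All.Properties as All
open import Data.List.Relation.Unary.Any using (here)
open import Data.Nat using (ℕ; zero; suc; _+_; _*_; _∸_; _^_; _/_; _%_; _≤_; _<_; z≤n; s≤s; _≡ᵇ_; _⊓_; _⊔_)
open import Data.Nat.Divisibility using (_∣_; quotient; module _∣_)
open import Data.Nat.DivMod using (%-distribˡ-+; m*n/n≡m; /-monoˡ-≤)
open import Data.Nat.Properties
open import Data.Product using (∃; _×_; _,_; proj₁; proj₂)
open import Data.Sum using (_⊎_; inj₁; inj₂)
open import Data.Vec using (Vec; []; _∷_; lookup; tabulate; replicate; head; tail)
open import Data.Vec.Properties using (zipWith-assoc; zipWith-comm; zipWith-identityˡ; zipWith-identityʳ; lookup∘tabulate; tabulate∘lookup; tabulate-cong; lookup-zipWith; lookup-replicate)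
open import Function using (_∘_; id; Equivalence)
open import Function.Bundles using (_⇔_; mk⇔)
open import Relation.Binary.PropositionalEquality
open import Relation.Nullary using (¬_; yes; no; does; contradiction)
open import Relation.Nullary.Decidable using (from-yes; ¬?; _→-dec_)

open BoolSolver.xor-∧-Solver using (solve; _:+_; _:*_; con; _:=_)

-- The vector space of words

𝟎 : ∀ {k} → Word k
𝟎 = replicate _ false

isZero : ∀ {k} → Word k → Bool
isZero []      = true
isZero (b ∷ v) = not b ∧ isZero v

isZero-𝟎 : ∀ k → isZero (𝟎 {k}) ≡ true
isZero-𝟎 zero    = refl
isZero-𝟎 (suc k) = isZero-𝟎 k

isZero⇒≡𝟎 : ∀ {k} (v : Word k) → isZero v ≡ true → v ≡ 𝟎
isZero⇒≡𝟎 []          _  = refl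
isZero⇒≡𝟎 (false ∷ v) eq = cong (false ∷_) (isZero⇒≡𝟎 v eq)

isZero-cong𝟎 : ∀ {k} {v : Word k} → v ≡ 𝟎 → isZero v ≡ true
isZero-cong𝟎 {k} refl = isZero-𝟎 k

isZero-false : ∀ {k} {v : Word k} → v ≢ 𝟎 → isZero v ≡ false
isZero-false {v = v} v≢0 with isZero v in eq
... | true  = contradiction (isZero⇒≡𝟎 v eq) v≢0
... | false = refl

⊕-assoc : ∀ {k} (u v w : Word k) → (u ⊕ v) ⊕ w ≡ u ⊕ (v ⊕ w)
⊕-assoc = zipWith-assoc xor-assoc

⊕-comm : ∀ {k} (u v : Word k) → u ⊕ v ≡ v ⊕ u
⊕-comm = zipWith-comm xor-comm

⊕-identityˡ : ∀ {k} (v : Word k) → 𝟎 ⊕ v ≡ v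
⊕-identityˡ = zipWith-identityˡ xor-identityˡ

⊕-identityʳ : ∀ {k} (v : Word k) → v ⊕ 𝟎 ≡ v
⊕-identityʳ = zipWith-identityʳ xor-identityʳ

⊕-self : ∀ {k} (v : Word k) → v ⊕ v ≡ 𝟎
⊕-self []      = refl
⊕-self (b ∷ v) = cong₂ _∷_ (xor-same b) (⊕-self v)

⊕-cancel : ∀ {k} (u v : Word k) → u ⊕ (u ⊕ v) ≡ v
⊕-cancel u v = trans (sym (⊕-assoc u u v)) (trans (cong (_⊕ v) (⊕-self u)) (⊕-identityˡ v))

⊕-cancelʳ : ∀ {k} (u v : Word k) → (u ⊕ v) ⊕ v ≡ u
⊕-cancelʳ u v = trans (⊕-assoc u v v) (trans (cong (u ⊕_) (⊕-self v)) (⊕-identityʳ u))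

⊕≡𝟎⇒≡ : ∀ {k} (u v : Word k) → u ⊕ v ≡ 𝟎 → u ≡ v
⊕≡𝟎⇒≡ u v eq = trans (sym (⊕-cancelʳ u v)) (trans (cong (_⊕ v) eq) (⊕-identityˡ v))

⊕-commutativeMonoid : ℕ → CommutativeMonoid _ _
⊕-commutativeMonoid k = record
  { Carrier = Word k ; _≈_ = _≡_ ; _∙_ = _⊕_ ; ε = 𝟎
  ; isCommutativeMonoid = record
    { isMonoid = record
      { isSemigroup = record
        { isMagma = record { isEquivalence = isEquivalence ; ∙-cong = cong₂ _⊕_ }
        ; assoc = ⊕-assoc }
      ; identity = ⊕-identityˡ , ⊕-identityʳ }
    ; comm = ⊕-comm } }

⊕-interchange : ∀ {k} (a b c d : Word k) → (a ⊕ b) ⊕ (c ⊕ d) ≡ (a ⊕ c) ⊕ (b ⊕ d)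
⊕-interchange {k} = interchange
  where open CommutativeSemigroupProperties (CommutativeMonoid.commutativeSemigroup (⊕-commutativeMonoid k))

infixr 25 _·_

_·_ : ∀ {k} → Bool → Word k → Word k
true  · v = v
false · v = 𝟎

·-distribʳ : ∀ {k} b c (v : Word k) → (b xor c) · v ≡ b · v ⊕ c · v
·-distribʳ false c     v = sym (⊕-identityˡ (c · v))
·-distribʳ true  false v = sym (⊕-identityʳ v)
·-distribʳ true  true  v = sym (⊕-self v)

-- Quadratic forms on words

parity-⊕ : ∀ {k} (u v : Word k) → parity (u ⊕ v) ≡ parity u xor parity v
parity-⊕ []      []      = refl
parity-⊕ (b ∷ u) (c ∷ v) rewrite parity-⊕ u v =
  solve 4 (λ b c p q → (b :+ c) :+ (p :+ q) := (b :+ p) :+ (c :+ q)) refl b c (parity u) (parity v)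

parity-𝟎 : ∀ k → parity (𝟎 {k}) ≡ false
parity-𝟎 zero    = refl
parity-𝟎 (suc k) = parity-𝟎 k

dot-comm : ∀ {k} (u v : Word k) → dot u v ≡ dot v u
dot-comm u v = cong parity (zipWith-comm ∧-comm u v)

dot-⊕ʳ : ∀ {k} (u v w : Word k) → dot u (v ⊕ w) ≡ dot u v xor dot u w
dot-⊕ʳ []      []      []      = refl
dot-⊕ʳ (a ∷ u) (b ∷ v) (c ∷ w) rewrite dot-⊕ʳ u v w =
  solve 5 (λ a b c p q → a :* (b :+ c) :+ (p :+ q) := (a :* b :+ p) :+ (a :* c :+ q)) refl
    a b c (dot u v) (dot u w)

dot-self : ∀ {k} (v : Word k) → dot v v ≡ parity v
dot-self []          = refl
dot-self (false ∷ v) = dot-self v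
dot-self (true ∷ v)  = cong not (dot-self v)

e₂ : ∀ {k} → Word k → Bool
e₂ []      = false
e₂ (b ∷ v) = e₂ v xor (b ∧ parity v)

-- The sum of u_i v_j over all i ≠ j: the product of the parities runs over all pairs of indices,
-- and the dot product removes the diagonal.
⟪_,_⟫ : ∀ {k} → Word k → Word k → Bool
⟪ u , v ⟫ = (parity u ∧ parity v) xor dot u v

e₂-⊕ : ∀ {k} (u v : Word k) → e₂ (u ⊕ v) ≡ (e₂ u xor e₂ v) xor ⟪ u , v ⟫
e₂-⊕ []      []      = refl
e₂-⊕ (b ∷ u) (c ∷ v) rewrite e₂-⊕ u v | parity-⊕ u v =
  solve 7 (λ b c p q x y d →
      ((x :+ y) :+ (p :* q :+ d)) :+ (b :+ c) :* (p :+ q) :=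
      ((x :+ b :* p) :+ (y :+ c :* q)) :+ ((b :+ p) :* (c :+ q) :+ (b :* c :+ d))) refl
    b c (parity u) (parity v) (e₂ u) (e₂ v) (dot u v)

⟪⟫-comm : ∀ {k} (u v : Word k) → ⟪ u , v ⟫ ≡ ⟪ v , u ⟫
⟪⟫-comm u v = cong₂ _xor_ (∧-comm (parity u) (parity v)) (dot-comm u v)

⟪⟫-⊕ʳ : ∀ {k} (u v w : Word k) → ⟪ u , v ⊕ w ⟫ ≡ ⟪ u , v ⟫ xor ⟪ u , w ⟫
⟪⟫-⊕ʳ u v w rewrite parity-⊕ v w | dot-⊕ʳ u v w =
  solve 5 (λ p q r x y → p :* (q :+ r) :+ (x :+ y) := (p :* q :+ x) :+ (p :* r :+ y)) refl
    (parity u) (parity v) (parity w) (dot u v) (dot u w)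

⟪⟫-⊕ˡ : ∀ {k} (u v w : Word k) → ⟪ u ⊕ v , w ⟫ ≡ ⟪ u , w ⟫ xor ⟪ v , w ⟫
⟪⟫-⊕ˡ u v w = begin
  ⟪ u ⊕ v , w ⟫             ≡⟨ ⟪⟫-comm (u ⊕ v) w ⟩
  ⟪ w , u ⊕ v ⟫             ≡⟨ ⟪⟫-⊕ʳ w u v ⟩
  ⟪ w , u ⟫ xor ⟪ w , v ⟫   ≡⟨ cong₂ _xor_ (⟪⟫-comm w u) (⟪⟫-comm w v) ⟩
  ⟪ u , w ⟫ xor ⟪ v , w ⟫   ∎
  where open ≡-Reasoning

⟪⟫-self : ∀ {k} (v : Word k) → ⟪ v , v ⟫ ≡ false
⟪⟫-self v rewrite dot-self v with parity v
... | true  = refl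
... | false = refl

unit : ∀ {k} → Fin k → Word k
unit zero    = true ∷ 𝟎
unit (suc i) = false ∷ unit i

parity-unit : ∀ {k} (i : Fin k) → parity (unit i) ≡ true
parity-unit {suc k} zero    = cong not (parity-𝟎 k)
parity-unit         (suc i) = parity-unit i

dot-zeroʳ : ∀ {k} (v : Word k) → dot v 𝟎 ≡ false
dot-zeroʳ []      = refl
dot-zeroʳ (b ∷ v) = trans (cong (_xor dot v 𝟎) (∧-zeroʳ b)) (dot-zeroʳ v)

dot-unit : ∀ {k} (v : Word k) (i : Fin k) → dot v (unit i) ≡ lookup v i
dot-unit (false ∷ v) zero = dot-zeroʳ v
dot-unit (true ∷ v)  zero = cong not (dot-zeroʳ v)
dot-unit (b ∷ v) (suc i)  = trans (cong (_xor dot v (unit i)) (∧-zeroʳ b)) (dot-unit v i)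

⟪⟫-zeroˡ : ∀ {k} (v : Word k) → ⟪ 𝟎 , v ⟫ ≡ false
⟪⟫-zeroˡ {k} v = cong₂ (λ p d → (p ∧ parity v) xor d) (parity-𝟎 k) (trans (dot-comm 𝟎 v) (dot-zeroʳ v))

constant-parity : ∀ j b → parity (replicate (j * 2) b) ≡ false
constant-parity zero    b = refl
constant-parity (suc j) b rewrite constant-parity j b = trans (cong (b xor_) (xor-identityʳ b)) (xor-same b)

constant-or-entry : ∀ {k} b (v : Word k) → v ≡ replicate k b ⊎ ∃ λ i → lookup v i ≡ not b
constant-or-entry b     []          = inj₁ refl
constant-or-entry false (true ∷ v)  = inj₂ (zero , refl)
constant-or-entry true  (false ∷ v) = inj₂ (zero , refl)
constant-or-entry false (false ∷ v) with constant-or-entry false v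
... | inj₁ eq       = inj₁ (cong (false ∷_) eq)
... | inj₂ (i , eq) = inj₂ (suc i , eq)
constant-or-entry true (true ∷ v) with constant-or-entry true v
... | inj₁ eq       = inj₁ (cong (true ∷_) eq)
... | inj₂ (i , eq) = inj₂ (suc i , eq)

-- ⟪ v , w ⟫ is the dot product of w with v + s₁(v) (1,…,1), which vanishes only
-- for v = s₁(v) (1,…,1); such a v of even length has s₁(v) = 0.
⟪⟫-nondegenerate : ∀ {k} j → k ≡ j * 2 → (v : Word k) → v ≢ 𝟎 → ∃ λ w → ⟪ v , w ⟫ ≡ true
⟪⟫-nondegenerate j refl v v≢0 with constant-or-entry (parity v) v
... | inj₂ (i , eq) = unit i , (begin
  (parity v ∧ parity (unit i)) xor dot v (unit i)
    ≡⟨ cong₂ (λ a b → (parity v ∧ a) xor b) (parity-unit i) (trans (dot-unit v i) eq) ⟩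
  (parity v ∧ true) xor not (parity v)
    ≡⟨ b∧⊤xor¬b (parity v) ⟩
  true ∎)
  where
  open ≡-Reasoning
  b∧⊤xor¬b : ∀ b → (b ∧ true) xor not b ≡ true
  b∧⊤xor¬b false = refl
  b∧⊤xor¬b true  = refl
... | inj₁ eq = contradiction (trans eq (cong (replicate _) even)) v≢0
  where
  even : parity v ≡ false
  even = trans (cong parity eq) (constant-parity j (parity v))

-- The weight modulo 4 has binary digits parity and e₂.
residue : Bool → Bool → ℕ
residue false false = 0
residue true  false = 1
residue false true  = 2
residue true  true  = 3

wt%4 : ∀ {k} (v : Word k) → wt v % 4 ≡ residue (parity v) (e₂ v)
wt%4 []          = refl
wt%4 (false ∷ v) = trans (wt%4 v) (cong (residue (parity v)) (sym (xor-identityʳ (e₂ v))))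
wt%4 (true ∷ v)  = begin
  suc (wt v) % 4                                    ≡⟨ %-distribˡ-+ 1 (wt v) 4 ⟩
  suc (wt v % 4) % 4                                ≡⟨ cong (λ r → suc r % 4) (wt%4 v) ⟩
  suc (residue (parity v) (e₂ v)) % 4               ≡⟨ carry (parity v) (e₂ v) ⟩
  residue (not (parity v)) (e₂ v xor parity v)      ∎
  where
  open ≡-Reasoning
  carry : ∀ p e → suc (residue p e) % 4 ≡ residue (not p) (e xor p)
  carry false false = refl
  carry false true  = refl
  carry true  false = refl
  carry true  true  = refl

-- Syndromes

syn : ∀ {n k} → (Fin n → Word k) → Word n → Word k
syn h []      = 𝟎
syn h (b ∷ x) = b · h zero ⊕ syn (h ∘ suc) x

syn-cong : ∀ {n k} {g h : Fin n → Word k} → (∀ i → g i ≡ h i) → ∀ x → syn g x ≡ syn h x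
syn-cong eq []      = refl
syn-cong eq (b ∷ x) = cong₂ (λ u v → b · u ⊕ v) (eq zero) (syn-cong (eq ∘ suc) x)

syn-⊕ : ∀ {n k} (h : Fin n → Word k) x y → syn h (x ⊕ y) ≡ syn h x ⊕ syn h y
syn-⊕ h []      []      = sym (⊕-self 𝟎)
syn-⊕ h (b ∷ x) (c ∷ y) = begin
  (b xor c) · h zero ⊕ syn (h ∘ suc) (x ⊕ y)
    ≡⟨ cong₂ _⊕_ (·-distribʳ b c (h zero)) (syn-⊕ (h ∘ suc) x y) ⟩
  (b · h zero ⊕ c · h zero) ⊕ (syn (h ∘ suc) x ⊕ syn (h ∘ suc) y)
    ≡⟨ ⊕-interchange (b · h zero) (c · h zero) _ _ ⟩
  (b · h zero ⊕ syn (h ∘ suc) x) ⊕ (c · h zero ⊕ syn (h ∘ suc) y) ∎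
  where open ≡-Reasoning

syn-𝟎 : ∀ {n k} (h : Fin n → Word k) → syn h 𝟎 ≡ 𝟎
syn-𝟎 {zero}  h = refl
syn-𝟎 {suc n} h = trans (⊕-identityˡ _) (syn-𝟎 (h ∘ suc))

-- Additive maps applied to columns

Additive : ∀ {k l} → (Word k → Word l) → Set
Additive A = ∀ u v → A (u ⊕ v) ≡ A u ⊕ A v

additive-𝟎 : ∀ {k l} {A : Word k → Word l} → Additive A → A 𝟎 ≡ 𝟎
additive-𝟎 {A = A} add = begin
  A 𝟎             ≡⟨ cong A (⊕-self 𝟎) ⟨
  A (𝟎 ⊕ 𝟎)       ≡⟨ add 𝟎 𝟎 ⟩
  A 𝟎 ⊕ A 𝟎       ≡⟨ ⊕-self (A 𝟎) ⟩
  𝟎               ∎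
  where open ≡-Reasoning

additive-· : ∀ {k l} {A : Word k → Word l} → Additive A → ∀ b v → A (b · v) ≡ b · A v
additive-· add false v = additive-𝟎 add
additive-· add true  v = refl

-- A syndrome is a sum of columns, so an additive map can be applied before or after summing. This
-- serves to drop a check (`tail`), to add a redundant one (`insert`) and to read a permutation of
-- columns as a linear map of syndromes.
syn-additive : ∀ {n k l} {A : Word k → Word l} → Additive A →
  ∀ (h : Fin n → Word k) x → syn (A ∘ h) x ≡ A (syn h x)
syn-additive add h [] = sym (additive-𝟎 add)
syn-additive {A = A} add h (b ∷ x) = begin
  b · A (h zero) ⊕ syn (A ∘ h ∘ suc) x
    ≡⟨ cong₂ _⊕_ (sym (additive-· add b (h zero))) (syn-additive add (h ∘ suc) x) ⟩
  A (b · h zero) ⊕ A (syn (h ∘ suc) x)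
    ≡⟨ add _ _ ⟨
  A (b · h zero ⊕ syn (h ∘ suc) x) ∎
  where open ≡-Reasoning

lookup-· : ∀ {k} b (v : Word k) i → lookup (b · v) i ≡ b ∧ lookup v i
lookup-· true  v       i       = refl
lookup-· false (_ ∷ v) zero    = refl
lookup-· false (_ ∷ v) (suc i) = lookup-· false v i

lookup-syn : ∀ {n k} (h : Fin n → Word k) x i → lookup (syn h x) i ≡ dot (tabulate λ j → lookup (h j) i) x
lookup-syn h []      i = lookup-· false 𝟎 i
lookup-syn h (b ∷ x) i = begin
  lookup (b · h zero ⊕ syn (h ∘ suc) x) i
    ≡⟨ lookup-zipWith _xor_ i (b · h zero) _ ⟩
  lookup (b · h zero) i xor lookup (syn (h ∘ suc) x) i
    ≡⟨ cong₂ _xor_ (lookup-· b (h zero) i) (lookup-syn (h ∘ suc) x i) ⟩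
  (b ∧ lookup (h zero) i) xor dot (tabulate λ j → lookup (h (suc j)) i) x
    ≡⟨ cong (_xor dot (tabulate λ j → lookup (h (suc j)) i) x) (∧-comm b _) ⟩
  (lookup (h zero) i ∧ b) xor dot (tabulate λ j → lookup (h (suc j)) i) x ∎
  where open ≡-Reasoning

-- The word added by `flipAt`, written in the same form so that `flipAt x i` unfolds to
-- `x ⊕ point i`.
point : ∀ {n} → Fin n → Word n
point i = tabulate (λ j → does (i F.≟ j))

tabulate-false : ∀ n → tabulate {n = n} (λ _ → false) ≡ 𝟎
tabulate-false zero    = refl
tabulate-false (suc n) = cong (false ∷_) (tabulate-false n)

syn-point : ∀ {n k} (h : Fin n → Word k) i → syn h (point i) ≡ h i
syn-point {suc n} h zero    = begin
  h zero ⊕ syn (h ∘ suc) (tabulate λ _ → false)  ≡⟨ cong (λ x → h zero ⊕ syn (h ∘ suc) x) (tabulate-false n) ⟩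
  h zero ⊕ syn (h ∘ suc) 𝟎                       ≡⟨ cong (h zero ⊕_) (syn-𝟎 (h ∘ suc)) ⟩
  h zero ⊕ 𝟎                                     ≡⟨ ⊕-identityʳ _ ⟩
  h zero                                         ∎
  where open ≡-Reasoning
syn-point h (suc i) = trans (⊕-identityˡ _) (syn-point (h ∘ suc) i)

syn-flipAt : ∀ {n k} (h : Fin n → Word k) x i → syn h (flipAt x i) ≡ h i ⊕ syn h x
syn-flipAt h x i = begin
  syn h (x ⊕ point i)         ≡⟨ syn-⊕ h x (point i) ⟩
  syn h x ⊕ syn h (point i)   ≡⟨ cong (syn h x ⊕_) (syn-point h i) ⟩
  syn h x ⊕ h i               ≡⟨ ⊕-comm _ _ ⟩
  h i ⊕ syn h x               ∎
  where open ≡-Reasoning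

module _ {k : ℕ} where
  private module Σ⊕ = Sum (⊕-commutativeMonoid k)

  syn-as-sum : ∀ {n} (h : Fin n → Word k) x → syn h x ≡ Σ⊕.sum (λ i → lookup x i · h i)
  syn-as-sum h []      = refl
  syn-as-sum h (b ∷ x) = cong (b · h zero ⊕_) (syn-as-sum (h ∘ suc) x)

  -- Reindexing the sum of columns along `π` moves the permutation from the entries of the word to
  -- the columns, where it appears as its inverse.
  syn-act : ∀ {n} (h : Fin n → Word k) (π : Permutation′ n) x →
    syn h (act π x) ≡ syn (λ i → h (π ⟨$⟩ˡ i)) x
  syn-act {n} h π x = begin
    syn h (act π x)
      ≡⟨ syn-as-sum h (act π x) ⟩
    Σ⊕.sum (λ i → lookup (act π x) i · h i)
      ≡⟨ Σ⊕.sum-cong-≗ {n} (λ i → cong₂ _·_ (lookup∘tabulate (λ j → lookup x (π ⟨$⟩ʳ j)) i) (cong h (sym (inverseˡ π)))) ⟩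
    Σ⊕.sum (λ i → lookup x (π ⟨$⟩ʳ i) · h (π ⟨$⟩ˡ (π ⟨$⟩ʳ i)))
      ≡⟨ Σ⊕.sum-permute (λ i → lookup x i · h (π ⟨$⟩ˡ i)) π ⟨
    Σ⊕.sum (λ i → lookup x i · h (π ⟨$⟩ˡ i))
      ≡⟨ syn-as-sum _ x ⟨
    syn (λ i → h (π ⟨$⟩ˡ i)) x ∎
    where open ≡-Reasoning

-- Counting

module Σℕ = Sum +-0-commutativeMonoid

𝟙 : Bool → ℕ
𝟙 b = if b then 1 else 0

count : ∀ {n} → (Fin n → Bool) → ℕ
count p = Σℕ.sum (𝟙 ∘ p)

-- Turns the list counts of `neighboursAt` into finite sums, which can be reindexed and added
-- termwise. The function `g` is arbitrary so that the induction can pass to `g ∘ suc`.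
length-filter-tabulate : ∀ {A : Set} {n} (p : A → Bool) (g : Fin n → A) →
  L.length (L.filterᵇ p (L.tabulate g)) ≡ count (p ∘ g)
length-filter-tabulate {n = zero}  p g = refl
length-filter-tabulate {n = suc n} p g with p (g zero)
... | true  = cong suc (length-filter-tabulate p (g ∘ suc))
... | false = length-filter-tabulate p (g ∘ suc)

count-cong : ∀ {n} {p q : Fin n → Bool} → (∀ i → p i ≡ q i) → count p ≡ count q
count-cong eq = Σℕ.sum-cong-≗ (λ i → cong 𝟙 (eq i))

count-not : ∀ {n} (p : Fin n → Bool) → count p + count (not ∘ p) ≡ n
count-not {n} p = trans (sym (Σℕ.∑-distrib-+ (𝟙 ∘ p) (𝟙 ∘ not ∘ p))) (all-ones _ (λ i → one+ (p i)))
  where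
  one+ : ∀ b → 𝟙 b + 𝟙 (not b) ≡ 1
  one+ true  = refl
  one+ false = refl
  all-ones : ∀ {n} (f : Fin n → ℕ) → (∀ i → f i ≡ 1) → Σℕ.sum f ≡ n
  all-ones {zero}  f eq = refl
  all-ones {suc n} f eq = cong₂ _+_ (eq zero) (all-ones (f ∘ suc) (eq ∘ suc))

count-none : ∀ {n} {p : Fin n → Bool} → (∀ i → p i ≡ false) → count p ≡ 0
count-none {n} eq = trans (count-cong eq) (Σℕ.sum-replicate-zero n)

count-all : ∀ {n} {p : Fin n → Bool} → (∀ i → p i ≡ true) → count p ≡ n
count-all {n} {p} eq = begin
  count p                       ≡⟨ +-identityʳ _ ⟨
  count p + 0                   ≡⟨ cong (count p +_) (count-none (λ i → cong not (eq i))) ⟨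
  count p + count (not ∘ p)     ≡⟨ count-not p ⟩
  n                             ∎
  where open ≡-Reasoning

count-unique : ∀ {n} {p : Fin n → Bool} i → p i ≡ true → (∀ j → p j ≡ true → j ≡ i) → count p ≡ 1
count-unique {suc n} {p} i pi uniq = begin
  count p                                        ≡⟨ Σℕ.sum-remove {i = i} (𝟙 ∘ p) ⟩
  𝟙 (p i) + count (λ j → p (F.punchIn i j))      ≡⟨ cong₂ _+_ (cong 𝟙 pi) (count-none others) ⟩
  1                                              ∎
  where
  open ≡-Reasoning
  others : ∀ j → p (F.punchIn i j) ≡ false
  others j with p (F.punchIn i j) in eq
  ... | true  = contradiction (uniq _ eq) (punchInᵢ≢i i j)
  ... | false = refl

-- The permutation matches the indices where `p` holds with those where it fails, so the two sets
-- have the same size.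
count-half : ∀ {n} {p : Fin n → Bool} (π : Permutation′ n) → (∀ i → p (π ⟨$⟩ʳ i) ≡ not (p i)) → count p * 2 ≡ n
count-half {n} {p} π swap = begin
  count p * 2                        ≡⟨ *-comm (count p) 2 ⟩
  count p + (count p + 0)            ≡⟨ cong (count p +_) (+-identityʳ _) ⟩
  count p + count p                  ≡⟨ cong (count p +_) (Σℕ.sum-permute (𝟙 ∘ p) π) ⟩
  count p + count (p ∘ (π ⟨$⟩ʳ_))    ≡⟨ cong (count p +_) (count-cong swap) ⟩
  count p + count (not ∘ p)          ≡⟨ count-not p ⟩
  n                                  ∎
  where open ≡-Reasoning

-- Counting over all words, and the size of a kernel

count-words : ∀ {n} → (Word n → Bool) → ℕ
count-words {zero}  p = 𝟙 (p [])
count-words {suc n} p = count-words (p ∘ (false ∷_)) + count-words (p ∘ (true ∷_))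

length-filter-map : ∀ {A B : Set} (p : B → Bool) (f : A → B) xs →
  L.length (L.filterᵇ p (L.map f xs)) ≡ L.length (L.filterᵇ (p ∘ f) xs)
length-filter-map p f L.[]       = refl
length-filter-map p f (x L.∷ xs) with p (f x)
... | true  = cong suc (length-filter-map p f xs)
... | false = length-filter-map p f xs

size≡count-words : ∀ {n} (C : Code n) → size C ≡ count-words C
size≡count-words {zero} C with C []
... | true  = refl
... | false = refl
size≡count-words {suc n} C = begin
  L.length (L.filterᵇ C (L.map (false ∷_) (allWords n) L.++ L.map (true ∷_) (allWords n)))
    ≡⟨ cong L.length (filter-++ (T? ∘ C) (L.map (false ∷_) (allWords n)) _) ⟩
  L.length (L.filterᵇ C (L.map (false ∷_) (allWords n)) L.++ L.filterᵇ C (L.map (true ∷_) (allWords n)))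
    ≡⟨ length-++ (L.filterᵇ C (L.map (false ∷_) (allWords n))) ⟩
  L.length (L.filterᵇ C (L.map (false ∷_) (allWords n))) + L.length (L.filterᵇ C (L.map (true ∷_) (allWords n)))
    ≡⟨ cong₂ _+_ (trans (length-filter-map C (false ∷_) (allWords n)) (size≡count-words (C ∘ (false ∷_))))
                 (trans (length-filter-map C (true ∷_) (allWords n)) (size≡count-words (C ∘ (true ∷_)))) ⟩
  count-words (C ∘ (false ∷_)) + count-words (C ∘ (true ∷_)) ∎
  where open ≡-Reasoning

count-words-cong : ∀ {n} {p q : Word n → Bool} → (∀ x → p x ≡ q x) → count-words p ≡ count-words q
count-words-cong {zero}  eq = cong 𝟙 (eq [])
count-words-cong {suc n} eq = cong₂ _+_ (count-words-cong (eq ∘ (false ∷_))) (count-words-cong (eq ∘ (true ∷_)))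

count-words-mono : ∀ {n} {p q : Word n → Bool} → (∀ x → p x ≡ true → q x ≡ true) → count-words p ≤ count-words q
count-words-mono {zero} {p} {q} imp with p [] in eq
... | true  = ≤-reflexive (cong 𝟙 (sym (imp [] eq)))
... | false = z≤n
count-words-mono {suc n} imp = +-mono-≤ (count-words-mono (imp ∘ (false ∷_))) (count-words-mono (imp ∘ (true ∷_)))

count-words-all : ∀ {n} → count-words {n} (λ _ → true) ≡ 2 ^ n
count-words-all {zero}  = refl
count-words-all {suc n} rewrite count-words-all {n} = cong (2 ^ n +_) (sym (+-identityʳ _))

count-words-split : ∀ {n} (p q : Word n → Bool) →
  count-words p ≡ count-words (λ x → not (q x) ∧ p x) + count-words (λ x → q x ∧ p x)
count-words-split {zero} p q with p [] | q []
... | true  | true  = refl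
... | true  | false = refl
... | false | true  = refl
... | false | false = refl
count-words-split {suc n} p q
  rewrite count-words-split (p ∘ (false ∷_)) (q ∘ (false ∷_)) | count-words-split (p ∘ (true ∷_)) (q ∘ (true ∷_)) =
  interchange (count-words (λ x → not (q (false ∷ x)) ∧ p (false ∷ x))) _ _ _
  where open import Algebra.Properties.CommutativeSemigroup +-commutativeSemigroup using (interchange)

count-words-translate : ∀ {n} (z : Word n) (p : Word n → Bool) → count-words (λ x → p (z ⊕ x)) ≡ count-words p
count-words-translate []          p = refl
count-words-translate (false ∷ z) p =
  cong₂ _+_ (count-words-translate z (p ∘ (false ∷_))) (count-words-translate z (p ∘ (true ∷_)))
count-words-translate (true ∷ z)  p = trans
  (cong₂ _+_ (count-words-translate z (p ∘ (true ∷_))) (count-words-translate z (p ∘ (false ∷_))))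
  (+-comm (count-words (p ∘ (true ∷_))) _)

none-or-some : ∀ {n} (p : Word n → Bool) → (count-words p ≡ 0) ⊎ ∃ λ x → p x ≡ true
none-or-some {zero} p with p [] in eq
... | true  = inj₂ ([] , eq)
... | false = inj₁ refl
none-or-some {suc n} p with none-or-some (p ∘ (false ∷_)) | none-or-some (p ∘ (true ∷_))
... | inj₂ (x , px) | _             = inj₂ (false ∷ x , px)
... | inj₁ _        | inj₂ (x , px) = inj₂ (true ∷ x , px)
... | inj₁ none     | inj₁ none′    = inj₁ (cong₂ _+_ none none′)

-- Each further parity check at most halves the kernel: translation by one
-- word violating it pairs the violating words with the satisfying ones.
kernel-large : ∀ {n k} (h : Fin n → Word k) → 2 ^ n ≤ 2 ^ k * count-words (isZero ∘ syn h)
kernel-large {n} {zero} h = ≤-reflexive (trans (sym (count-words-all {n}))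
  (trans (count-words-cong (λ x → sym (all-zero (syn h x)))) (sym (+-identityʳ _))))
  where
  all-zero : (v : Word 0) → isZero v ≡ true
  all-zero [] = refl
kernel-large {n} {suc k} h = begin
  2 ^ n                                                ≤⟨ kernel-large t ⟩
  2 ^ k * count-words K                                ≤⟨ *-monoʳ-≤ (2 ^ k) halved ⟩
  2 ^ k * (2 * count-words (λ x → not (a x) ∧ K x))    ≡⟨ *-assoc (2 ^ k) 2 _ ⟨
  2 ^ k * 2 * count-words (λ x → not (a x) ∧ K x)      ≡⟨ cong₂ _*_ (*-comm (2 ^ k) 2) (count-words-cong restrict) ⟩
  2 ^ suc k * count-words (isZero ∘ syn h)             ∎
  where
  open ≤-Reasoning
  t : Fin n → Word k
  t = tail ∘ h
  a K : Word n → Bool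
  a = head ∘ syn h
  K = isZero ∘ syn t
  tail-additive : Additive {suc k} tail
  tail-additive (_ ∷ _) (_ ∷ _) = refl
  head-⊕ : ∀ (u v : Word (suc k)) → head (u ⊕ v) ≡ head u xor head v
  head-⊕ (_ ∷ _) (_ ∷ _) = refl
  restrict : ∀ x → (not (a x) ∧ K x) ≡ isZero (syn h x)
  restrict x rewrite syn-additive tail-additive h x with syn h x
  ... | _ ∷ _ = refl
  halved : count-words K ≤ 2 * count-words (λ x → not (a x) ∧ K x)
  halved with none-or-some (λ x → a x ∧ K x)
  ... | inj₁ none = begin
    count-words K                                                                   ≡⟨ count-words-split K a ⟩
    count-words (λ x → not (a x) ∧ K x) + count-words (λ x → a x ∧ K x)             ≡⟨ cong (count-words (λ x → not (a x) ∧ K x) +_) none ⟩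
    count-words (λ x → not (a x) ∧ K x) + 0                                         ≤⟨ +-monoʳ-≤ _ z≤n ⟩
    2 * count-words (λ x → not (a x) ∧ K x)                                         ∎
  ... | inj₂ (z , az∧Kz) = begin
    count-words K                                                                   ≡⟨ count-words-split K a ⟩
    count-words (λ x → not (a x) ∧ K x) + count-words (λ x → a x ∧ K x)             ≡⟨ cong (count-words (λ x → not (a x) ∧ K x) +_) (count-words-translate z _) ⟨
    count-words (λ x → not (a x) ∧ K x) + count-words (λ x → a (z ⊕ x) ∧ K (z ⊕ x)) ≡⟨ cong (count-words (λ x → not (a x) ∧ K x) +_) (trans (count-words-cong shift) (sym (+-identityʳ _))) ⟩
    2 * count-words (λ x → not (a x) ∧ K x)                                         ∎
    where
    both : ∀ p q → p ∧ q ≡ true → p ≡ true × q ≡ true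
    both true true _ = refl , refl
    az : a z ≡ true
    az = proj₁ (both (a z) (K z) az∧Kz)
    Kz : syn t z ≡ 𝟎
    Kz = isZero⇒≡𝟎 _ (proj₂ (both (a z) (K z) az∧Kz))
    shift : ∀ x → (a (z ⊕ x) ∧ K (z ⊕ x)) ≡ (not (a x) ∧ K x)
    shift x = cong₂ _∧_
      (trans (cong head (syn-⊕ h z x)) (trans (head-⊕ (syn h z) (syn h x)) (cong (_xor a x) az)))
      (cong isZero (trans (syn-⊕ t z x) (trans (cong (_⊕ syn t x) Kz) (⊕-identityˡ _))))

-- Words as elements of Fin (2 ^ n)

encode : ∀ {n} → Word n → Fin (2 ^ n)
encode []          = zero
encode (false ∷ v) = F.combine {2} zero (encode v)
encode (true ∷ v)  = F.combine {2} (suc zero) (encode v)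

encode-injective : ∀ {n} (u v : Word n) → encode u ≡ encode v → u ≡ v
encode-injective []          []          _  = refl
encode-injective {suc n} (false ∷ u) (false ∷ v) eq =
  cong (false ∷_) (encode-injective u v (proj₂ (combine-injective {2} {2 ^ n} zero (encode u) zero (encode v) eq)))
encode-injective {suc n} (true ∷ u)  (true ∷ v)  eq =
  cong (true ∷_) (encode-injective u v (proj₂ (combine-injective {2} {2 ^ n} (suc zero) (encode u) (suc zero) (encode v) eq)))
encode-injective {suc n} (false ∷ u) (true ∷ v)  eq
  with () ← proj₁ (combine-injective {2} {2 ^ n} zero (encode u) (suc zero) (encode v) eq)
encode-injective {suc n} (true ∷ u)  (false ∷ v) eq
  with () ← proj₁ (combine-injective {2} {2 ^ n} (suc zero) (encode u) zero (encode v) eq)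

word-pigeonhole : ∀ {n k} → 2 ^ k < n → (f : Fin n → Word k) → ∃ λ i → ∃ λ j → i F.< j × f i ≡ f j
word-pigeonhole lt f with pigeonhole lt (encode ∘ f)
... | i , j , i<j , eq = i , j , i<j , encode-injective _ _ eq

-- The pigeonhole principle is applied to `v` together with the values of `f`. Two values of `f`
-- cannot coincide, so the coincidence involves `v`.
injective⇒surjective : ∀ {n k} → 2 ^ k ≡ n → (f : Fin n → Word k) → (∀ i j → f i ≡ f j → i ≡ j) →
  ∀ v → ∃ λ i → f i ≡ v
injective⇒surjective {n} {k} size f inj v with word-pigeonhole (s≤s (≤-reflexive size)) g
  where
  g : Fin (suc n) → Word k
  g zero    = v
  g (suc i) = f i
... | zero  , suc j , _   , eq = j , sym eq
... | suc i , suc j , i<j , eq = contradiction (cong toℕ (inj i j eq)) (<⇒≢ (≤-pred i<j))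

-- Orbits of an injective map on words

module _ {n : ℕ} (f : Word n → Word n) (inj : ∀ x y → f x ≡ f y → x ≡ y) where

  private
    iter : ℕ → Word n → Word n
    iter zero    x = x
    iter (suc i) x = f (iter i x)

    iter-+ : ∀ i j x → iter (i + j) x ≡ iter i (iter j x)
    iter-+ zero    j x = refl
    iter-+ (suc i) j x = cong f (iter-+ i j x)

    iter-injective : ∀ i x y → iter i x ≡ iter i y → x ≡ y
    iter-injective zero    x y eq = eq
    iter-injective (suc i) x y eq = iter-injective i x y (inj _ _ eq)

    period : ∀ x → ∃ λ d → iter (suc d) x ≡ x
    period x with word-pigeonhole (n<1+n (2 ^ n)) (λ i → iter (toℕ i) x)
    ... | i , j , i<j , eq with m≤n⇒∃[o]m+o≡n i<j
    ...   | d , 1+i+d≡j = d , sym (iter-injective (toℕ i) _ _ (begin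
      iter (toℕ i) x                    ≡⟨ eq ⟩
      iter (toℕ j) x                    ≡⟨ cong (λ l → iter l x) (trans (+-suc (toℕ i) d) 1+i+d≡j) ⟨
      iter (toℕ i + suc d) x            ≡⟨ iter-+ (toℕ i) (suc d) x ⟩
      iter (toℕ i) (iter (suc d) x)     ∎))
      where open ≡-Reasoning

  -- Every `x` lies on a cycle of `f`, so it is reached again from `f x` by applying `f` further,
  -- and `P` survives each application.
  closed-under-inverse : (P : Word n → Set) → (∀ x → P x → P (f x)) → ∀ x → P (f x) → P x
  closed-under-inverse P closed x Pfx with period x
  ... | d , eq = subst P (trans (sym (trans (cong (λ l → iter l x) (+-comm 1 d)) (iter-+ d 1 x))) eq) (orbit d)
    where
    orbit : ∀ i → P (iter i (f x))
    orbit zero    = Pfx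
    orbit (suc i) = closed _ (orbit i)

-- Weights

wt≤length : ∀ {n} (x : Word n) → wt x ≤ n
wt≤length []          = z≤n
wt≤length (false ∷ x) = m≤n⇒m≤1+n (wt≤length x)
wt≤length (true ∷ x)  = s≤s (wt≤length x)

wt-𝟎 : ∀ n → wt (𝟎 {n}) ≡ 0
wt-𝟎 zero    = refl
wt-𝟎 (suc n) = wt-𝟎 n

wt≡0⇒syn≡𝟎 : ∀ {n k} (h : Fin n → Word k) y → wt y ≡ 0 → syn h y ≡ 𝟎
wt≡0⇒syn≡𝟎 h []          _  = refl
wt≡0⇒syn≡𝟎 h (false ∷ y) eq = trans (⊕-identityˡ _) (wt≡0⇒syn≡𝟎 (h ∘ suc) y eq)

-- Splitting off one column per unit of weight allows induction on the weight of a word.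
syn-peel : ∀ {n k} (h : Fin n → Word k) y {d} → wt y ≡ suc d →
  ∃ λ i → ∃ λ y′ → wt y′ ≡ d × syn h y ≡ h i ⊕ syn h y′
syn-peel h (true ∷ y)  eq = zero , false ∷ y , suc-injective eq , cong (h zero ⊕_) (sym (⊕-identityˡ _))
syn-peel h (false ∷ y) eq with syn-peel (h ∘ suc) y eq
... | i , y′ , wt≡ , syn≡ = suc i , false ∷ y′ , wt≡ ,
  trans (⊕-identityˡ _) (trans syn≡ (cong (h (suc i) ⊕_) (sym (⊕-identityˡ _))))

wt-flipAt : ∀ {n} (x : Word n) i → wt (flipAt x i) ≤ suc (wt x)
wt-flipAt {suc n} (b ∷ x) zero rewrite tabulate-false n | ⊕-identityʳ x = +-monoˡ-≤ (wt x) (bit b)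
  where
  bit : ∀ b → 𝟙 (b xor true) ≤ suc (𝟙 b)
  bit false = s≤s z≤n
  bit true  = z≤n
wt-flipAt (false ∷ x) (suc i) = wt-flipAt x i
wt-flipAt (true ∷ x)  (suc i) = s≤s (wt-flipAt x i)

wt-as-count : ∀ {n} (x : Word n) → wt x ≡ count (lookup x)
wt-as-count []      = refl
wt-as-count (b ∷ x) = cong (𝟙 b +_) (wt-as-count x)

wt-act : ∀ {n} (π : Permutation′ n) x → wt (act π x) ≡ wt x
wt-act {n} π x = begin
  wt (act π x)                       ≡⟨ wt-as-count (act π x) ⟩
  count (lookup (act π x))           ≡⟨ count-cong {n} (lookup∘tabulate (λ i → lookup x (π ⟨$⟩ʳ i))) ⟩
  count (λ i → lookup x (π ⟨$⟩ʳ i))  ≡⟨ Σℕ.sum-permute (𝟙 ∘ lookup x) π ⟨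
  count (lookup x)                   ≡⟨ wt-as-count x ⟨
  wt x                               ∎
  where open ≡-Reasoning

-- Coordinate permutations

act-⊕ : ∀ {n} (π : Permutation′ n) x y → act π (x ⊕ y) ≡ act π x ⊕ act π y
act-⊕ {n} π x y = trans (tabulate-cong (λ i → lookup-zipWith _xor_ (π ⟨$⟩ʳ i) x y)) (zip-tabulate _ _)
  where
  zip-tabulate : ∀ {n} (f g : Fin n → Bool) → tabulate (λ i → f i xor g i) ≡ tabulate f ⊕ tabulate g
  zip-tabulate {zero}  f g = refl
  zip-tabulate {suc n} f g = cong ((f zero xor g zero) ∷_) (zip-tabulate (f ∘ suc) (g ∘ suc))

act-∘ : ∀ {n} (π ρ : Permutation′ n) x → act (ρ ∘ₚ π) x ≡ act ρ (act π x)
act-∘ π ρ x = tabulate-cong (λ i → sym (lookup∘tabulate (λ j → lookup x (π ⟨$⟩ʳ j)) (ρ ⟨$⟩ʳ i)))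

act-inverse : ∀ {n} (π : Permutation′ n) x → act (flip π) (act π x) ≡ x
act-inverse π x = trans (sym (act-∘ π (flip π) x))
  (trans (tabulate-cong (λ i → cong (lookup x) (inverseʳ π))) (tabulate∘lookup x))

act-inverse′ : ∀ {n} (π : Permutation′ n) x → act π (act (flip π) x) ≡ x
act-inverse′ π x = trans (sym (act-∘ (flip π) π x))
  (trans (tabulate-cong (λ i → cong (lookup x) (inverseˡ π))) (tabulate∘lookup x))

-- `IsAut` only asks that codewords go to codewords. Since `act π` is injective on finitely many
-- words, its inverse is one of its iterates on each cycle and preserves the code too.
IsAut-flip : ∀ {n} (C : Code n) (π : Permutation′ n) → IsAut C π → IsAut C (flip π)
IsAut-flip C π aut c Cc = closed-under-inverse (act π) act-injective (λ x → C x ≡ true) aut _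
  (trans (cong C (act-inverse′ π c)) Cc)
  where
  act-injective : ∀ x y → act π x ≡ act π y → x ≡ y
  act-injective x y eq = trans (sym (act-inverse π x)) (trans (cong (act (flip π)) eq) (act-inverse π y))

-- Codes given by the columns of a parity check matrix

∈-allWords : ∀ {n} (x : Word n) → x ∈ allWords n
∈-allWords []          = here refl
∈-allWords (false ∷ x) = ∈-++⁺ˡ (∈-map⁺ (false ∷_) (∈-allWords x))
∈-allWords (true ∷ x)  = ∈-++⁺ʳ (L.map (false ∷_) (allWords _)) (∈-map⁺ (true ∷_) (∈-allWords x))

module LinearCode {N k : ℕ} (h : Fin N → Word k) (C : Code N)
  (codeword⇒ : ∀ x → C x ≡ true → syn h x ≡ 𝟎) (⇒codeword : ∀ x → syn h x ≡ 𝟎 → C x ≡ true) where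

  same-syn⇒codeword : ∀ x y → syn h x ≡ syn h y → C (x ⊕ y) ≡ true
  same-syn⇒codeword x y eq = ⇒codeword _
    (trans (syn-⊕ h x y) (trans (cong (_⊕ syn h y) eq) (⊕-self (syn h y))))

  codeword⇒same-syn : ∀ x y → C (x ⊕ y) ≡ true → syn h x ≡ syn h y
  codeword⇒same-syn x y Cxy = ⊕≡𝟎⇒≡ _ _ (trans (sym (syn-⊕ h x y)) (codeword⇒ _ Cxy))

  -- The codeword `x ⊕ y` lies at distance `wt y` from `x`. With `dC-attained`, the distance to the
  -- code becomes the minimum weight in the coset.
  dC-≤ : ∀ x y → syn h y ≡ syn h x → dC C x ≤ wt y
  dC-≤ x y eq = foldr-preservesᵒ smaller N (L.map (dist x) (codewords C))
    (inj₂ (lose (∈-map⁺ (dist x) (∈-filter⁺ (T? ∘ C) (∈-allWords (x ⊕ y))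
                   (Equivalence.from T-≡ (same-syn⇒codeword x y (sym eq)))))
                (≤-reflexive (cong wt (⊕-cancel x y)))))
    where
    smaller : ∀ a b → a ≤ wt y ⊎ b ≤ wt y → a ⊓ b ≤ wt y
    smaller a b (inj₁ a≤) = m≤n⇒m⊓o≤n b a≤
    smaller a b (inj₂ b≤) = m≤n⇒o⊓m≤n a b≤

  dC-attained : ∀ x → ∃ λ y → syn h y ≡ syn h x × wt y ≡ dC C x
  dC-attained x with foldr-selective ⊓-sel N (L.map (dist x) (codewords C))
  -- If the fold returns its default value N, then `x` itself attains it: its weight is at most N
  -- and at least the distance to the code.
  ... | inj₁ dC≡N = x , refl , ≤-antisym (≤-trans (wt≤length x) (≤-reflexive (sym dC≡N))) (dC-≤ x x refl)
  ... | inj₂ dC∈ with ∈-map⁻ (dist x) dC∈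
  ...   | c , c∈C , dC≡ = x ⊕ c ,
    trans (syn-⊕ h x c) (trans (cong (syn h x ⊕_) (codeword⇒ c Cc)) (⊕-identityʳ _)) , sym dC≡
    where
    Cc : C c ≡ true
    Cc = Equivalence.to T-≡ (proj₂ (∈-filter⁻ (T? ∘ C) {xs = allWords N} c∈C))

  infix 4 _↝_

  -- Cosets are identified with their syndromes; this is the action of the automorphism group on
  -- them.
  _↝_ : Word k → Word k → Set
  σ ↝ τ = ∃ λ π → IsAut C π × (∀ x → syn h x ≡ σ → syn h (act π x) ≡ τ)

  ↝-trans : ∀ {ρ σ τ} → ρ ↝ σ → σ ↝ τ → ρ ↝ τ
  ↝-trans (π , aut , eq) (π′ , aut′ , eq′) = π′ ∘ₚ π ,
    (λ c Cc → trans (cong C (act-∘ π π′ c)) (aut′ (act π c) (aut c Cc))) ,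
    (λ x syn≡ → trans (cong (syn h) (act-∘ π π′ x)) (eq′ (act π x) (eq x syn≡)))

  -- When permuting the columns has the effect of an additive map `A`, the syndrome of a permuted
  -- word is `A` of the old one; in particular syndrome zero is kept, so the permutation is an
  -- automorphism.
  additive-↝ : (π : Permutation′ N) {A : Word k → Word k} → Additive A →
    (∀ i → h (π ⟨$⟩ˡ i) ≡ A (h i)) → ∀ σ → σ ↝ A σ
  additive-↝ π {A} add cols σ = π ,
    (λ c Cc → ⇒codeword _ (trans (syn-act′ c) (trans (cong A (codeword⇒ c Cc)) (additive-𝟎 add)))) ,
    (λ x eq → trans (syn-act′ x) (cong A eq))
    where
    syn-act′ : ∀ x → syn h (act π x) ≡ A (syn h x)
    syn-act′ x = trans (syn-act h π x) (trans (syn-cong cols x) (syn-additive add h x))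

  -- A word of minimum weight in the coset of `x` is carried to a word of the same weight in the
  -- coset of `act π x`.
  dC-act-≤ : ∀ π → IsAut C π → ∀ x → dC C (act π x) ≤ dC C x
  dC-act-≤ π aut x with dC-attained x
  ... | y , syn≡ , wt≡ = ≤-trans (dC-≤ (act π x) (act π y) (codeword⇒same-syn _ _
      (trans (cong C (sym (act-⊕ π y x))) (aut _ (same-syn⇒codeword y x syn≡)))))
    (≤-reflexive (trans (wt-act π y) wt≡))

  dC-act : ∀ π → IsAut C π → ∀ x → dC C (act π x) ≡ dC C x
  dC-act π aut x = ≤-antisym (dC-act-≤ π aut x)
    (≤-trans (≤-reflexive (cong (dC C) (sym (act-inverse π x))))
             (dC-act-≤ (flip π) (IsAut-flip C π aut) (act π x)))

  -- A function δ on syndromes that changes by at most 1 along an edge and can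
  -- always be decreased is the distance to the code.
  module Distance (δ : Word k → ℕ) (δ-𝟎 : δ 𝟎 ≡ 0) (δ≡0 : ∀ σ → δ σ ≡ 0 → σ ≡ 𝟎)
    (δ-step : ∀ i σ → δ (h i ⊕ σ) ≤ suc (δ σ))
    (δ-descent : ∀ d σ → δ σ ≡ suc d → ∃ λ i → δ (h i ⊕ σ) ≡ d) where

    representative : ∀ d σ → δ σ ≡ d → ∃ λ y → syn h y ≡ σ × wt y ≤ d
    representative zero    σ eq = 𝟎 , trans (syn-𝟎 h) (sym (δ≡0 σ eq)) , ≤-reflexive (wt-𝟎 N)
    representative (suc d) σ eq with δ-descent d σ eq
    ... | i , δ≡d with representative d (h i ⊕ σ) δ≡d
    ...   | y , syn≡ , wt≤ = flipAt y i ,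
      trans (syn-flipAt h y i) (trans (cong (h i ⊕_) syn≡) (⊕-cancel (h i) σ)) ,
      ≤-trans (wt-flipAt y i) (s≤s wt≤)

    δ≤wt : ∀ w y → wt y ≡ w → δ (syn h y) ≤ w
    δ≤wt zero    y eq = ≤-reflexive (trans (cong δ (wt≡0⇒syn≡𝟎 h y eq)) δ-𝟎)
    δ≤wt (suc w) y eq with syn-peel h y eq
    ... | i , y′ , wt≡ , syn≡ = ≤-trans (≤-reflexive (cong δ syn≡))
      (≤-trans (δ-step i (syn h y′)) (s≤s (δ≤wt w y′ wt≡)))

    -- Walking down along `δ` yields a word of weight at most `δ` in the coset. Conversely, adding
    -- the columns of a shortest word one at a time raises `δ` from 0 by at most 1 per step.
    dC≡δ : ∀ x → dC C x ≡ δ (syn h x)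
    dC≡δ x with dC-attained x | representative _ (syn h x) refl
    ... | y , syn≡ , wt≡ | z , syn≡′ , wt≤ = ≤-antisym (≤-trans (dC-≤ x z syn≡′) wt≤)
      (≤-trans (≤-reflexive (cong δ (sym syn≡))) (δ≤wt _ y wt≡))

    neighboursAt≡ : ∀ x l → neighboursAt C x l ≡ count (λ i → δ (h i ⊕ syn h x) ≡ᵇ l)
    neighboursAt≡ x l = trans (length-filter-tabulate (λ i → dC C (flipAt x i) ≡ᵇ l) id)
      (count-cong (λ i → cong (_≡ᵇ l) (trans (dC≡δ (flipAt x i)) (cong δ (syn-flipAt h x i)))))

    module Levels {r : ℕ} (δ≤r : ∀ σ → δ σ ≤ r) (s : Fin (suc r) → Word k) (δ-s : ∀ j → δ (s j) ≡ toℕ j) where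

      word : Fin (suc r) → Word N
      word j = proj₁ (representative _ (s j) refl)

      syn-word : ∀ j → syn h (word j) ≡ s j
      syn-word j = proj₁ (proj₂ (representative _ (s j) refl))

      dC-word : ∀ j → dC C (word j) ≡ toℕ j
      dC-word j = trans (dC≡δ (word j)) (trans (cong δ (syn-word j)) (δ-s j))

      coveringRadius≡ : coveringRadius C ≡ r
      coveringRadius≡ = ≤-antisym
        (foldr-preservesᵇ {P = _≤ r} {f = _⊔_} ⊔-lub z≤n
          (All.map⁺ {xs = allWords N} (All.tabulate (λ {x} _ → ≤-trans (≤-reflexive (dC≡δ x)) (δ≤r (syn h x))))))
        (foldr-preservesᵒ larger 0 (L.map (dC C) (allWords N))
          (inj₂ (lose (∈-map⁺ (dC C) (∈-allWords (word (F.fromℕ r))))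
                      (≤-reflexive (sym (trans (dC-word (F.fromℕ r)) (toℕ-fromℕ r)))))))
        where
        larger : ∀ a b → r ≤ a ⊎ r ≤ b → r ≤ a ⊔ b
        larger a b (inj₁ ≤a) = m≤n⇒m≤n⊔o b ≤a
        larger a b (inj₂ ≤b) = m≤n⇒m≤o⊔n a ≤b

      -- Automorphisms preserve the distance to the code, so the chosen cosets lie in different
      -- orbits; transitivity within each distance leaves no further orbit.
      hasOrbitCount : (∀ j σ → δ σ ≡ toℕ j → s j ↝ σ) → HasOrbitCount C (suc r)
      hasOrbitCount transitive = tabulate word , cover , separate
        where
        cover : ∀ x → ∃ λ j → ∃ λ π → IsAut C π × SameCoset C (act π (lookup (tabulate word) j)) x
        cover x with transitive (F.fromℕ< (s≤s (δ≤r (syn h x)))) (syn h x) (sym (toℕ-fromℕ< (s≤s (δ≤r (syn h x)))))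
        ... | π , aut , moves = j , π , aut ,
          same-syn⇒codeword _ x (trans (cong (syn h ∘ act π) (lookup∘tabulate word j)) (moves (word j) (syn-word j)))
          where
          j : Fin (suc r)
          j = F.fromℕ< (s≤s (δ≤r (syn h x)))
        separate : ∀ j j′ π → IsAut C π →
          SameCoset C (act π (lookup (tabulate word) j)) (lookup (tabulate word) j′) → j ≡ j′
        separate j j′ π aut same = toℕ-injective (begin
          toℕ j                    ≡⟨ dC-word j ⟨
          dC C (word j)            ≡⟨ dC-act π aut (word j) ⟨
          dC C (act π (word j))    ≡⟨ dC≡δ (act π (word j)) ⟩
          δ (syn h (act π (word j)))
            ≡⟨ cong δ (codeword⇒same-syn _ _ (subst₂ (λ u v → SameCoset C (act π u) v)
                 (lookup∘tabulate word j) (lookup∘tabulate word j′) same)) ⟩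
          δ (syn h (word j′))      ≡⟨ dC≡δ (word j′) ⟨
          dC C (word j′)           ≡⟨ dC-word j′ ⟩
          toℕ j′                   ∎)
          where open ≡-Reasoning

-- Coordinates indexed by a vector space

module Coordinates {N m : ℕ} (φ : Fin N → Word m) (ψ : Word m → Fin N)
  (φψ : ∀ u → φ (ψ u) ≡ u) (ψφ : ∀ i → ψ (φ i) ≡ i) where

  -- Translations and transvections are involutions in characteristic 2, and for an involution both
  -- directions of the permutation are the same function.
  conjugate : (g : Word m → Word m) → (∀ u → g (g u) ≡ u) → Permutation′ N
  conjugate g invol = permutation g′ g′ g′-invol g′-invol
    where
    g′ : Fin N → Fin N
    g′ i = ψ (g (φ i))
    g′-invol : ∀ i → g′ (g′ i) ≡ i
    g′-invol i = trans (cong (ψ ∘ g) (φψ _)) (trans (cong ψ (invol (φ i))) (ψφ i))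

  count-at : ∀ s → count (λ i → isZero (φ i ⊕ s)) ≡ 1
  count-at s = count-unique (ψ s)
    (isZero-cong𝟎 (trans (cong (_⊕ s) (φψ s)) (⊕-self s)))
    (λ j eq → trans (sym (ψφ j)) (cong ψ (⊕≡𝟎⇒≡ (φ j) s (isZero⇒≡𝟎 (φ j ⊕ s) eq))))

  count-away : ∀ s → suc (count (λ i → not (isZero (φ i ⊕ s)))) ≡ N
  count-away s = trans (cong (_+ count (λ i → not (isZero (φ i ⊕ s)))) (sym (count-at s)))
    (count-not (λ i → isZero (φ i ⊕ s)))

  -- Translation by a word w with ⟪ w , s ⟫ ≡ true exchanges the two halves.
  count-hyperplane : ∀ b s → (∃ λ w → ⟪ s , w ⟫ ≡ true) → count (λ i → b xor ⟪ φ i , s ⟫) * 2 ≡ N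
  count-hyperplane b s (w , ⟪s,w⟫) = count-half (conjugate (_⊕ w) (λ u → ⊕-cancelʳ u w)) (λ i → begin
    b xor ⟪ φ (ψ (φ i ⊕ w)) , s ⟫       ≡⟨ cong (λ u → b xor ⟪ u , s ⟫) (φψ (φ i ⊕ w)) ⟩
    b xor ⟪ φ i ⊕ w , s ⟫               ≡⟨ cong (b xor_) (⟪⟫-⊕ˡ (φ i) w s) ⟩
    b xor (⟪ φ i , s ⟫ xor ⟪ w , s ⟫)   ≡⟨ cong (λ t → b xor (⟪ φ i , s ⟫ xor t)) (trans (⟪⟫-comm w s) ⟪s,w⟫) ⟩
    b xor (⟪ φ i , s ⟫ xor true)        ≡⟨ solve 2 (λ b t → b :+ (t :+ con true) := con true :+ (b :+ t)) refl b ⟪ φ i , s ⟫ ⟩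
    not (b xor ⟪ φ i , s ⟫)             ∎)
    where open ≡-Reasoning

column : ∀ {m} → (Word m → Bool) → Word m → Word (2 + m)
column f u = true ∷ f u ∷ u

-- The code of a nondegenerate quadratic form

module Bent {n m : ℕ} (φ : Fin (suc n) → Word m) (ψ : Word m → Fin (suc n))
  (φψ : ∀ u → φ (ψ u) ≡ u) (ψφ : ∀ i → ψ (φ i) ≡ i)
  (f : Word m → Bool) (f-⊕ : ∀ u v → f (u ⊕ v) ≡ (f u xor f v) xor ⟪ u , v ⟫)
  (nondegenerate : ∀ (v : Word m) → v ≢ 𝟎 → ∃ λ w → ⟪ v , w ⟫ ≡ true)
  (s₀ : Word m) (s₀≢𝟎 : s₀ ≢ 𝟎) (C : Code (suc n))
  (codeword⇒ : ∀ x → C x ≡ true → syn (column f ∘ φ) x ≡ 𝟎)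
  (⇒codeword : ∀ x → syn (column f ∘ φ) x ≡ 𝟎 → C x ≡ true) where

  open Coordinates φ ψ φψ ψφ

  h : Fin (suc n) → Word (2 + m)
  h = column f ∘ φ

  open LinearCode h C codeword⇒ ⇒codeword

  f-𝟎 : f 𝟎 ≡ false
  f-𝟎 = begin
    f 𝟎                                ≡⟨ cong f (⊕-self 𝟎) ⟨
    f (𝟎 ⊕ 𝟎)                          ≡⟨ f-⊕ 𝟎 𝟎 ⟩
    (f 𝟎 xor f 𝟎) xor ⟪ 𝟎 {m} , 𝟎 ⟫    ≡⟨ cong₂ _xor_ (xor-same (f 𝟎)) (⟪⟫-zeroˡ (𝟎 {m})) ⟩
    false                              ∎
    where open ≡-Reasoning

  -- The first entry of a syndrome is the parity of the weight. An odd syndrome is a column exactly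
  -- when e = f s, and otherwise lies at distance 3. For an even one with s ≠ 0, the columns at u
  -- and u + s add up to second entry f s + ⟪u, s⟫, which takes both values, so two columns suffice.
  -- For s = 0 two columns can only cancel, which leaves (0, 1, 0) at distance 4.
  δ : Word (2 + m) → ℕ
  δ (true ∷ e ∷ s)  = if e xor f s then 3 else 1
  δ (false ∷ e ∷ s) = if isZero s then (if e then 4 else 0) else 2

  -- Normal forms of the syndromes at each distance; matching on a level supplies the outcome of the
  -- tests made by `δ`.
  data Level : Word (2 + m) → Set where
    level0 : Level (false ∷ false ∷ 𝟎)
    level1 : ∀ s → Level (true ∷ f s ∷ s)
    level2 : ∀ e s → s ≢ 𝟎 → Level (false ∷ e ∷ s)
    level3 : ∀ s → Level (true ∷ not (f s) ∷ s)
    level4 : Level (false ∷ true ∷ 𝟎)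

  level : ∀ σ → Level σ
  level (true ∷ e ∷ s) with e B.≟ f s
  ... | yes refl = level1 s
  ... | no e≢fs  = subst (λ b → Level (true ∷ b ∷ s)) (sym (¬-not e≢fs)) (level3 s)
  level (false ∷ e ∷ s) with isZero s in eq
  level (false ∷ e ∷ s) | false = level2 e s (λ s≡𝟎 → contradiction (trans (sym eq) (isZero-cong𝟎 s≡𝟎)) λ ())
  level (false ∷ true ∷ s)  | true = subst (λ v → Level (false ∷ true ∷ v)) (sym (isZero⇒≡𝟎 s eq)) level4
  level (false ∷ false ∷ s) | true = subst (λ v → Level (false ∷ false ∷ v)) (sym (isZero⇒≡𝟎 s eq)) level0

  index : ∀ {σ} → Level σ → ℕ
  index level0         = 0
  index (level1 _)     = 1
  index (level2 _ _ _) = 2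
  index (level3 _)     = 3
  index level4         = 4

  δ≡index : ∀ {σ} (v : Level σ) → δ σ ≡ index v
  δ≡index level0 rewrite isZero-𝟎 m = refl
  δ≡index (level1 s) rewrite xor-same (f s) = refl
  δ≡index (level2 e s s≢𝟎) rewrite isZero-false s≢𝟎 = refl
  δ≡index (level3 s) rewrite xor-inverseˡ (f s) = refl
  δ≡index level4 rewrite isZero-𝟎 m = refl

  neighbour : ∀ {σ} → Level σ → Word m → ℕ
  neighbour level0         u = 1
  neighbour (level1 s)     u = if isZero (u ⊕ s) then 0 else 2
  neighbour (level2 e s _) u = if (e xor f s) xor ⟪ u , s ⟫ then 3 else 1
  neighbour (level3 s)     u = if isZero (u ⊕ s) then 4 else 2
  neighbour level4         u = 3

  -- From an odd syndrome, adding the column at u leads to an even one whose vector part u + s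
  -- vanishes only at u = s. From level 2, the new second entry e + f u is compared with f (u + s),
  -- and the difference is e + f s + ⟪u, s⟫.
  δ-neighbour : ∀ {σ} (v : Level σ) u → δ (column f u ⊕ σ) ≡ neighbour v u
  δ-neighbour level0 u rewrite ⊕-identityʳ u | xor-identityʳ (f u) | xor-same (f u) = refl
  δ-neighbour level4 u rewrite ⊕-identityʳ u =
    cong (if_then 3 else 1) (solve 1 (λ a → (a :+ con true) :+ a := con true) refl (f u))
  δ-neighbour (level1 s) u with isZero (u ⊕ s) in eq
  ... | false = refl
  ... | true rewrite ⊕≡𝟎⇒≡ u s (isZero⇒≡𝟎 (u ⊕ s) eq) | xor-same (f s) = refl
  δ-neighbour (level3 s) u with isZero (u ⊕ s) in eq
  ... | false = refl
  ... | true rewrite ⊕≡𝟎⇒≡ u s (isZero⇒≡𝟎 (u ⊕ s) eq) | xor-inverseʳ (f s) = refl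
  δ-neighbour (level2 e s _) u rewrite f-⊕ u s =
    cong (if_then 3 else 1)
      (solve 4 (λ a e b c → (a :+ e) :+ ((a :+ b) :+ c) := (e :+ b) :+ c) refl (f u) e (f s) ⟪ u , s ⟫)

  δ-𝟎 : δ 𝟎 ≡ 0
  δ-𝟎 = δ≡index level0

  δ≡0 : ∀ σ → δ σ ≡ 0 → σ ≡ 𝟎
  δ≡0 σ eq with level σ | trans (sym (δ≡index (level σ))) eq
  ... | level0 | _ = refl

  δ-step : ∀ i σ → δ (h i ⊕ σ) ≤ suc (δ σ)
  δ-step i σ = subst₂ _≤_ (sym (δ-neighbour v (φ i))) (cong suc (sym (δ≡index v))) (step v)
    where
    v = level σ
    step : ∀ {σ} (v : Level σ) → neighbour v (φ i) ≤ suc (index v)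
    step level0 = ≤-refl
    step level4 = ≤ᵇ⇒≤ 3 5 _
    step (level1 s) with isZero (φ i ⊕ s)
    ... | true  = z≤n
    ... | false = ≤-refl
    step (level2 e s _) with (e xor f s) xor ⟪ φ i , s ⟫
    ... | true  = ≤-refl
    ... | false = s≤s z≤n
    step (level3 s) with isZero (φ i ⊕ s)
    ... | true  = ≤-refl
    ... | false = ≤ᵇ⇒≤ 2 4 _

  descend : ∀ {σ} (v : Level σ) d → index v ≡ suc d → ∃ λ u → neighbour v u ≡ d
  descend (level1 s) _ refl = s , cong (if_then 0 else 2) (isZero-cong𝟎 (⊕-self s))
  -- A vector u with ⟪u, s⟫ = e + f s is wanted: zero serves for the value 0, and nondegeneracy
  -- supplies one for the value 1.
  descend (level2 e s s≢𝟎) _ refl with e xor f s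
  ... | false = 𝟎 , cong (if_then 3 else 1) (⟪⟫-zeroˡ s)
  ... | true with nondegenerate s s≢𝟎
  ...   | w , ⟪s,w⟫ = w , cong (λ b → if not b then 3 else 1) (trans (⟪⟫-comm w s) ⟪s,w⟫)
  -- Any vector other than s leads to level 2; s₀ + s is one because s₀ is nonzero.
  descend (level3 s) _ refl = s₀ ⊕ s , cong (if_then 4 else 2)
    (isZero-false (λ eq → s₀≢𝟎 (trans (sym (⊕-cancelʳ s₀ s)) eq)))
  descend level4 _ refl = 𝟎 , refl

  δ-descent : ∀ d σ → δ σ ≡ suc d → ∃ λ i → δ (h i ⊕ σ) ≡ d
  δ-descent d σ eq with descend (level σ) d (trans (sym (δ≡index (level σ))) eq)
  ... | u , nb = ψ u , trans (cong (λ w → δ (column f w ⊕ σ)) (φψ u)) (trans (δ-neighbour (level σ) u) nb)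

  open Distance δ δ-𝟎 δ≡0 δ-step δ-descent

  representatives : Fin 5 → Word (2 + m)
  representatives zero                         = false ∷ false ∷ 𝟎
  representatives (suc zero)                   = true ∷ false ∷ 𝟎
  representatives (suc (suc zero))             = false ∷ false ∷ s₀
  representatives (suc (suc (suc zero)))       = true ∷ true ∷ 𝟎
  representatives (suc (suc (suc (suc zero)))) = false ∷ true ∷ 𝟎

  δ-representatives : ∀ j → δ (representatives j) ≡ toℕ j
  δ-representatives zero                         = δ≡index level0
  δ-representatives (suc zero)                   = cong (if_then 3 else 1) f-𝟎
  δ-representatives (suc (suc zero))             = δ≡index (level2 false s₀ s₀≢𝟎)
  δ-representatives (suc (suc (suc zero)))       = cong (λ b → if not b then 3 else 1) f-𝟎
  δ-representatives (suc (suc (suc (suc zero)))) = δ≡index level4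

  index≤4 : ∀ {σ} (v : Level σ) → index v ≤ 4
  index≤4 level0         = z≤n
  index≤4 (level1 _)     = ≤ᵇ⇒≤ 1 4 _
  index≤4 (level2 _ _ _) = ≤ᵇ⇒≤ 2 4 _
  index≤4 (level3 _)     = ≤ᵇ⇒≤ 3 4 _
  index≤4 level4         = ≤-refl

  open Levels (λ σ → ≤-trans (≤-reflexive (δ≡index (level σ))) (index≤4 (level σ))) representatives δ-representatives
    public using (coveringRadius≡; hasOrbitCount)

  -- Intersection numbers

  count-half-plane : ∀ b s → s ≢ 𝟎 → count (λ i → b xor ⟪ φ i , s ⟫) ≡ suc n / 2
  count-half-plane b s s≢𝟎 = sym (trans (cong (_/ 2) (sym (count-hyperplane b s (nondegenerate s s≢𝟎)))) (m*n/n≡m _ 2))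

  neighbours-above : ∀ {σ} (v : Level σ) (j : Fin 4) → index v ≡ toℕ j →
    count (λ i → neighbour v (φ i) ≡ᵇ suc (toℕ j)) ≡ lookup (suc n ∷ n ∷ suc n / 2 ∷ 1 ∷ []) j
  neighbours-above level0 j eq with refl ← toℕ-injective {j = zero} (sym eq) = count-all {suc n} (λ _ → refl)
  neighbours-above (level1 s) j eq with refl ← toℕ-injective {j = suc zero} (sym eq) =
    trans (count-cong {suc n} (λ i → pick (isZero (φ i ⊕ s)))) (suc-injective (count-away s))
    where
    pick : ∀ b → ((if b then 0 else 2) ≡ᵇ 2) ≡ not b
    pick true  = refl
    pick false = refl
  neighbours-above (level2 e s s≢𝟎) j eq with refl ← toℕ-injective {j = suc (suc zero)} (sym eq) =
    trans (count-cong {suc n} (λ i → pick ((e xor f s) xor ⟪ φ i , s ⟫))) (count-half-plane (e xor f s) s s≢𝟎)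
    where
    pick : ∀ b → ((if b then 3 else 1) ≡ᵇ 3) ≡ b
    pick true  = refl
    pick false = refl
  neighbours-above (level3 s) j eq with refl ← toℕ-injective {j = suc (suc (suc zero))} (sym eq) =
    trans (count-cong {suc n} (λ i → pick (isZero (φ i ⊕ s)))) (count-at s)
    where
    pick : ∀ b → ((if b then 4 else 2) ≡ᵇ 4) ≡ b
    pick true  = refl
    pick false = refl
  neighbours-above level4 j eq = contradiction (≤-reflexive eq) (<⇒≱ (toℕ<n j))

  neighbours-below : ∀ {σ} (v : Level σ) (j : Fin 4) → index v ≡ suc (toℕ j) →
    count (λ i → neighbour v (φ i) ≡ᵇ toℕ j) ≡ lookup (1 ∷ suc n / 2 ∷ n ∷ suc n ∷ []) j
  neighbours-below (level1 s) j eq with refl ← toℕ-injective {j = zero} (sym (suc-injective eq)) =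
    trans (count-cong {suc n} (λ i → pick (isZero (φ i ⊕ s)))) (count-at s)
    where
    pick : ∀ b → ((if b then 0 else 2) ≡ᵇ 0) ≡ b
    pick true  = refl
    pick false = refl
  neighbours-below (level2 e s s≢𝟎) j eq with refl ← toℕ-injective {j = suc zero} (sym (suc-injective eq)) =
    -- The neighbours below form the complement of those above, which is the parallel half with the
    -- opposite constant.
    trans (count-cong {suc n} (λ i → pick (e xor f s) ⟪ φ i , s ⟫)) (count-half-plane (not (e xor f s)) s s≢𝟎)
    where
    pick : ∀ a b → ((if a xor b then 3 else 1) ≡ᵇ 1) ≡ not a xor b
    pick true  true  = refl
    pick true  false = refl
    pick false true  = refl
    pick false false = refl
  neighbours-below (level3 s) j eq with refl ← toℕ-injective {j = suc (suc zero)} (sym (suc-injective eq)) =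
    trans (count-cong {suc n} (λ i → pick (isZero (φ i ⊕ s)))) (suc-injective (count-away s))
    where
    pick : ∀ b → ((if b then 4 else 2) ≡ᵇ 2) ≡ not b
    pick true  = refl
    pick false = refl
  neighbours-below level4 j eq with refl ← toℕ-injective {j = suc (suc (suc zero))} (sym (suc-injective eq)) =
    count-all {suc n} (λ _ → refl)

  neighbours : ∀ x l → neighboursAt C x l ≡ count (λ i → neighbour (level (syn h x)) (φ i) ≡ᵇ l)
  neighbours x l = trans (neighboursAt≡ x l)
    (count-cong {suc n} (λ i → cong (_≡ᵇ l) (δ-neighbour (level (syn h x)) (φ i))))

  dC≡index : ∀ x → dC C x ≡ index (level (syn h x))
  dC≡index x = trans (dC≡δ x) (δ≡index (level (syn h x)))

  hasIntersectionArray : HasIntersectionArray C 4 (suc n ∷ n ∷ suc n / 2 ∷ 1 ∷ []) (1 ∷ suc n / 2 ∷ n ∷ suc n ∷ [])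
  hasIntersectionArray = coveringRadius≡ ,
    (λ x j eq → trans (neighbours x _) (neighbours-above (level (syn h x)) j (trans (sym (dC≡index x)) eq))) ,
    (λ x j eq → trans (neighbours x _) (neighbours-below (level (syn h x)) j (trans (sym (dC≡index x)) eq)))

  -- Automorphisms from translations and transvections

  ↝-refl : ∀ σ → σ ↝ σ
  ↝-refl = additive-↝ Perm.id (λ _ _ → refl) (λ _ → refl)

  -- The linear map of syndromes that sends the column at u to the column at u + w. The terms f w
  -- and w of the affine formulas are multiplied by the first entry, which is 1 on columns.
  translate : Word m → Word (2 + m) → Word (2 + m)
  translate w (a ∷ e ∷ s) = a ∷ (((a ∧ f w) xor e) xor ⟪ s , w ⟫) ∷ s ⊕ a · w

  translate-↝ : ∀ w σ → σ ↝ translate w σ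
  translate-↝ w = additive-↝ (conjugate (_⊕ w) (λ u → ⊕-cancelʳ u w)) additive columns
    where
    additive : Additive (translate w)
    additive (a ∷ e ∷ s) (a′ ∷ e′ ∷ s′) = cong₂ (λ x y → (a xor a′) ∷ x ∷ y)
      (trans (cong ((((a xor a′) ∧ f w) xor (e xor e′)) xor_) (⟪⟫-⊕ˡ s s′ w))
        (solve 7 (λ a a′ e e′ q x y →
            ((a :+ a′) :* q :+ (e :+ e′)) :+ (x :+ y) := ((a :* q :+ e) :+ x) :+ ((a′ :* q :+ e′) :+ y))
          refl a a′ e e′ (f w) ⟪ s , w ⟫ ⟪ s′ , w ⟫))
      (trans (cong ((s ⊕ s′) ⊕_) (·-distribʳ a a′ w)) (⊕-interchange s s′ (a · w) (a′ · w)))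
    columns : ∀ i → h (ψ (φ i ⊕ w)) ≡ translate w (h i)
    columns i rewrite φψ (φ i ⊕ w) | f-⊕ (φ i) w | xor-comm (f (φ i)) (f w) = refl

  transvect : Word m → Word m → Word m
  transvect v u = u ⊕ ⟪ u , v ⟫ · v

  transvect-involutive : ∀ v u → transvect v (transvect v u) ≡ u
  transvect-involutive v u =
    trans (cong (λ b → transvect v u ⊕ b · v) same) (⊕-cancelʳ u (⟪ u , v ⟫ · v))
    where
    isotropic : ∀ b → ⟪ b · v , v ⟫ ≡ false
    isotropic true  = ⟪⟫-self v
    isotropic false = ⟪⟫-zeroˡ v
    same : ⟪ transvect v u , v ⟫ ≡ ⟪ u , v ⟫
    same = trans (⟪⟫-⊕ˡ u (⟪ u , v ⟫ · v) v)
      (trans (cong (⟪ u , v ⟫ xor_) (isotropic ⟪ u , v ⟫)) (xor-identityʳ _))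

  transvect-⊕ : ∀ v → Additive (transvect v)
  transvect-⊕ v s t = trans
    (cong (λ b → (s ⊕ t) ⊕ b · v) (⟪⟫-⊕ˡ s t v))
    (trans (cong ((s ⊕ t) ⊕_) (·-distribʳ ⟪ s , v ⟫ ⟪ t , v ⟫ v)) (⊕-interchange s t (⟪ s , v ⟫ · v) (⟪ t , v ⟫ · v)))

  -- If ⟪u, v⟫ = 1, then f (u + v) = f u + f v + 1. So a transvection along v with f v = 1 preserves
  -- f, and otherwise it changes f by the linear function ⟪u, v⟫, which the second entry in
  -- `transvect′` absorbs.
  f-transvect : ∀ v u → f (transvect v u) ≡ f u xor (⟪ u , v ⟫ ∧ not (f v))
  f-transvect v u with ⟪ u , v ⟫ in eq
  ... | false = trans (cong f (⊕-identityʳ u)) (sym (xor-identityʳ (f u)))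
  ... | true  = trans (f-⊕ u v) (trans (cong ((f u xor f v) xor_) eq)
    (solve 2 (λ a b → (a :+ b) :+ con true := a :+ (con true :+ b)) refl (f u) (f v)))

  transvect′ : Word m → Word (2 + m) → Word (2 + m)
  transvect′ v (a ∷ e ∷ s) = a ∷ (e xor (⟪ s , v ⟫ ∧ not (f v))) ∷ transvect v s

  transvect-↝ : ∀ v σ → σ ↝ transvect′ v σ
  transvect-↝ v = additive-↝ (conjugate (transvect v) (transvect-involutive v)) additive columns
    where
    additive : Additive (transvect′ v)
    additive (a ∷ e ∷ s) (a′ ∷ e′ ∷ s′) = cong₂ (λ x y → (a xor a′) ∷ x ∷ y)
      (trans (cong (λ b → (e xor e′) xor (b ∧ not (f v))) (⟪⟫-⊕ˡ s s′ v))
        (solve 5 (λ e e′ q x y → (e :+ e′) :+ (x :+ y) :* q := (e :+ x :* q) :+ (e′ :+ y :* q))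
          refl e e′ (not (f v)) ⟪ s , v ⟫ ⟪ s′ , v ⟫))
      (transvect-⊕ v s s′)
    columns : ∀ i → h (ψ (transvect v (φ i))) ≡ transvect′ v (h i)
    columns i rewrite φψ (transvect v (φ i)) | f-transvect v (φ i) = refl

  -- Translation by t. The choice e = 0 reaches all of level 1 and e = 1 all of level 3.
  odd-↝ : ∀ e t → (true ∷ e ∷ 𝟎) ↝ (true ∷ (f t xor e) ∷ t)
  odd-↝ e t = subst ((true ∷ e ∷ 𝟎) ↝_)
    (cong₂ (λ x y → true ∷ x ∷ y)
      (trans (cong ((f t xor e) xor_) (⟪⟫-zeroˡ t)) (xor-identityʳ _)) (⊕-identityˡ t))
    (translate-↝ t (true ∷ e ∷ 𝟎))

  -- On even syndromes a translation by w fixes the vector part t and adds ⟪t, w⟫ to the second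
  -- entry.
  adjust-↝ : ∀ e e′ t → t ≢ 𝟎 → (false ∷ e ∷ t) ↝ (false ∷ e′ ∷ t)
  adjust-↝ e e′ t t≢𝟎 with e B.≟ e′ | nondegenerate t t≢𝟎
  ... | yes refl | _          = ↝-refl _
  ... | no e≢e′  | w , ⟪t,w⟫ = subst ((false ∷ e ∷ t) ↝_)
    (cong₂ (λ x y → false ∷ x ∷ y)
      (trans (cong (e xor_) ⟪t,w⟫) (trans (xor-comm e true) (sym (¬-not (e≢e′ ∘ sym)))))
      (⊕-identityʳ t))
    (translate-↝ w (false ∷ e ∷ t))

  -- Since ⟪s, s + t⟫ = ⟪s, t⟫ = 1, the transvection along s + t takes s to t. The second entry is
  -- left open, to be corrected by `adjust-↝`.
  hyperbolic-↝ : ∀ e s t → ⟪ s , t ⟫ ≡ true → ∃ λ e′ → (false ∷ e ∷ s) ↝ (false ∷ e′ ∷ t)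
  hyperbolic-↝ e s t ⟪s,t⟫ = _ , subst ((false ∷ e ∷ s) ↝_)
    (cong (λ y → false ∷ (e xor (⟪ s , s ⊕ t ⟫ ∧ not (f (s ⊕ t)))) ∷ y)
      (trans (cong (λ b → s ⊕ b · (s ⊕ t)) one-pairing) (⊕-cancel s t)))
    (transvect-↝ (s ⊕ t) (false ∷ e ∷ s))
    where
    one-pairing : ⟪ s , s ⊕ t ⟫ ≡ true
    one-pairing = trans (⟪⟫-⊕ʳ s s t) (cong₂ _xor_ (⟪⟫-self s) ⟪s,t⟫)

  -- If the partner of s is orthogonal to t and the partner of t orthogonal to s, their sum pairs to
  -- 1 with both. The result links any two nonzero vectors by two transvections.
  common-partner : ∀ s t → s ≢ 𝟎 → t ≢ 𝟎 → ∃ λ w → ⟪ s , w ⟫ ≡ true × ⟪ t , w ⟫ ≡ true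
  common-partner s t s≢𝟎 t≢𝟎 with nondegenerate s s≢𝟎 | nondegenerate t t≢𝟎
  ... | w , ⟪s,w⟫ | w′ , ⟪t,w′⟫ with ⟪ t , w ⟫ in ⟪t,w⟫ | ⟪ s , w′ ⟫ in ⟪s,w′⟫
  ...   | true  | _     = w , ⟪s,w⟫ , ⟪t,w⟫
  ...   | false | true  = w′ , ⟪s,w′⟫ , ⟪t,w′⟫
  ...   | false | false = w ⊕ w′ ,
    trans (⟪⟫-⊕ʳ s w w′) (cong₂ _xor_ ⟪s,w⟫ ⟪s,w′⟫) ,
    trans (⟪⟫-⊕ʳ t w w′) (cong₂ _xor_ ⟪t,w⟫ ⟪t,w′⟫)

  even-↝ : ∀ e e′ s t → s ≢ 𝟎 → t ≢ 𝟎 → (false ∷ e ∷ s) ↝ (false ∷ e′ ∷ t)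
  even-↝ e e′ s t s≢𝟎 t≢𝟎 =
    let w , ⟪s,w⟫ , ⟪t,w⟫ = common-partner s t s≢𝟎 t≢𝟎
        e₁ , s↝w = hyperbolic-↝ e s w ⟪s,w⟫
        e₂′ , w↝t = hyperbolic-↝ e₁ w t (trans (⟪⟫-comm w t) ⟪t,w⟫)
    in ↝-trans s↝w (↝-trans w↝t (adjust-↝ e₂′ e′ t t≢𝟎))

  transitive : ∀ j {σ} (v : Level σ) → index v ≡ toℕ j → representatives j ↝ σ
  transitive j level0 eq with refl ← toℕ-injective {j = zero} (sym eq) = ↝-refl _
  transitive j (level1 s) eq with refl ← toℕ-injective {j = suc zero} (sym eq) =
    subst (λ b → (true ∷ false ∷ 𝟎) ↝ (true ∷ b ∷ s)) (xor-identityʳ (f s)) (odd-↝ false s)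
  transitive j (level2 e s s≢𝟎) eq with refl ← toℕ-injective {j = suc (suc zero)} (sym eq) =
    even-↝ false e s₀ s s₀≢𝟎 s≢𝟎
  transitive j (level3 s) eq with refl ← toℕ-injective {j = suc (suc (suc zero))} (sym eq) =
    subst (λ b → (true ∷ true ∷ 𝟎) ↝ (true ∷ b ∷ s)) (xor-comm (f s) true) (odd-↝ true s)
  transitive j level4 eq with refl ← toℕ-injective {j = suc (suc (suc (suc zero)))} (sym eq) = ↝-refl _

  completelyTransitive : CompletelyTransitive C
  completelyTransitive = subst (HasOrbitCount C ∘ suc) (sym coveringRadius≡)
    (hasOrbitCount (λ j σ eq → transitive j (level σ) (trans (sym (δ≡index (level σ))) eq)))

-- A quadratic form altered at the origin

module Altered {n m : ℕ} (φ : Fin (suc n) → Word m) (ψ : Word m → Fin (suc n))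
  (φψ : ∀ u → φ (ψ u) ≡ u) (ψφ : ∀ i → ψ (φ i) ≡ i)
  (q : Word m → Bool) (μ : Bool) (q-⊕ : ∀ u v → q (u ⊕ v) ≡ (q u xor q v) xor (μ ∧ ⟪ u , v ⟫))
  (s : Word m) (s≢𝟎 : s ≢ 𝟎) (C : Code (suc n)) where

  -- Away from the origin this is 1 + q, the case c = 1; at the origin it is q, as the coordinate ∞
  -- has entry 0 in the appended row.
  f : Word m → Bool
  f u = not (isZero u) xor q u

  module _
    (codeword⇒ : ∀ x → C x ≡ true → syn (column f ∘ φ) x ≡ 𝟎)
    (⇒codeword : ∀ x → syn (column f ∘ φ) x ≡ 𝟎 → C x ≡ true) where

    open Coordinates φ ψ φψ ψφ

    h : Fin (suc n) → Word (2 + m)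
    h = column f ∘ φ

    open LinearCode h C codeword⇒ ⇒codeword

    dC≡0⇒ : ∀ x → dC C x ≡ 0 → syn h x ≡ 𝟎
    dC≡0⇒ x eq with dC-attained x
    ... | y , syn≡ , wt≡ = trans (sym syn≡) (wt≡0⇒syn≡𝟎 h y (trans wt≡ eq))

    dC≡1⇒ : ∀ x → dC C x ≡ 1 → ∃ λ u → syn h x ≡ column f u
    dC≡1⇒ x eq with dC-attained x
    ... | y , syn≡ , wt≡ with syn-peel h y (trans wt≡ eq)
    ...   | i , y′ , wt≡0 , syn≡′ = φ i ,
      trans (sym syn≡) (trans syn≡′ (trans (cong (h i ⊕_) (wt≡0⇒syn≡𝟎 h y′ wt≡0)) (⊕-identityʳ (h i))))

    pair : Word m → Word m → Word (suc n)
    pair u v = flipAt (flipAt 𝟎 (ψ u)) (ψ v)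

    wt-pair : ∀ u v → wt (pair u v) ≤ 2
    wt-pair u v = ≤-trans (wt-flipAt (flipAt 𝟎 (ψ u)) (ψ v)) (s≤s (≤-trans (wt-flipAt 𝟎 (ψ u)) (s≤s (≤-reflexive (wt-𝟎 (suc n))))))

    syn-single : ∀ u → syn h (flipAt 𝟎 (ψ u)) ≡ column f u
    syn-single u = trans (syn-flipAt h 𝟎 (ψ u))
      (trans (cong₂ _⊕_ (cong (column f) (φψ u)) (syn-𝟎 h)) (⊕-identityʳ _))

    syn-pair : ∀ u v → syn h (pair u v) ≡ column f v ⊕ column f u
    syn-pair u v = trans (syn-flipAt h (flipAt 𝟎 (ψ u)) (ψ v)) (cong₂ _⊕_ (cong (column f) (φψ v)) (syn-single u))

    -- An odd coset is at distance 1 exactly when its syndrome is a column, and a column is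
    -- determined by its vector part.
    dC-odd : ∀ x e v → syn h x ≡ true ∷ e ∷ v → (dC C x ≡ᵇ 1) ≡ not (e xor f v)
    dC-odd x e v eq with e B.≟ f v
    ... | yes refl = trans (cong (_≡ᵇ 1) (≤-antisym at-most at-least)) (cong not (sym (xor-same (f v))))
      where
      at-most : dC C x ≤ 1
      at-most = ≤-trans (dC-≤ x (flipAt 𝟎 (ψ v)) (trans (syn-single v) (sym eq)))
        (≤-trans (wt-flipAt 𝟎 (ψ v)) (s≤s (≤-reflexive (wt-𝟎 (suc n)))))
      at-least : 1 ≤ dC C x
      at-least = n≢0⇒n>0 (λ dC≡0 → contradiction (cong head (trans (sym eq) (dC≡0⇒ x dC≡0))) λ ())
    ... | no e≢fv with dC C x ≡ᵇ 1 in eq₁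
    ...   | false = cong not (sym (trans (cong (_xor f v) (¬-not e≢fv)) (xor-inverseˡ (f v))))
    ...   | true with dC≡1⇒ x (≡ᵇ⇒≡ _ 1 (Equivalence.from T-≡ eq₁))
    ...     | u , eq₂ = contradiction (trans (cong (head ∘ tail) (trans (sym eq) eq₂))
      (cong f (cong (tail ∘ tail) (trans (sym eq₂) eq)))) e≢fv

    x₀ : Word (suc n)
    x₀ = pair 𝟎 s

    -- The weight gives the upper bound. The vector part s ≠ 0 excludes distance 0, and even parity
    -- excludes distance 1.
    dC-x₀ : dC C x₀ ≡ 2
    dC-x₀ = ≤-antisym (≤-trans (dC-≤ x₀ x₀ refl) (wt-pair 𝟎 s)) (at-least (dC C x₀) refl)
      where
      at-least : ∀ d → dC C x₀ ≡ d → 2 ≤ d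
      at-least 0 eq = contradiction (trans (sym (⊕-identityʳ s))
        (cong (tail ∘ tail) (trans (sym (syn-pair 𝟎 s)) (dC≡0⇒ x₀ eq)))) s≢𝟎
      at-least 1 eq with dC≡1⇒ x₀ eq
      ... | u , eq′ = contradiction (cong head (trans (sym (syn-pair 𝟎 s)) eq′)) λ ()
      at-least (suc (suc d)) _ = s≤s (s≤s z≤n)

    near : ∀ i → (dC C (flipAt x₀ i) ≡ᵇ 1) ≡ not ((f (φ i) xor (f s xor f 𝟎)) xor f (φ i ⊕ s))
    near i = dC-odd (flipAt x₀ i) _ _ (trans (syn-flipAt h x₀ i)
      (cong₂ _⊕_ (refl {x = h i}) (trans (syn-pair 𝟎 s) (cong (λ v → false ∷ (f s xor f 𝟎) ∷ v) (⊕-identityʳ s)))))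

    f-𝟎 : f 𝟎 ≡ false
    f-𝟎 = begin
      not (isZero (𝟎 {m})) xor q 𝟎     ≡⟨ cong₂ _xor_ (cong not (isZero-𝟎 m)) (trans (cong q (sym (⊕-self 𝟎))) (q-⊕ 𝟎 𝟎)) ⟩
      (q 𝟎 xor q 𝟎) xor (μ ∧ ⟪ 𝟎 {m} , 𝟎 ⟫)
        ≡⟨ cong₂ _xor_ (xor-same (q 𝟎)) (trans (cong (μ ∧_) (⟪⟫-zeroˡ (𝟎 {m}))) (∧-zeroʳ μ)) ⟩
      false                            ∎
      where open ≡-Reasoning

    -- The form q contributes its polar form, and the alteration at the origin contributes the tests
    -- u = 0 and u = s. The constants at u, s and u + s cancel against the outer negation.
    f-derivative : ∀ u → not ((f u xor (f s xor f 𝟎)) xor f (u ⊕ s)) ≡ (isZero u xor isZero (u ⊕ s)) xor (μ ∧ ⟪ u , s ⟫)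
    f-derivative u rewrite f-𝟎 | isZero-false s≢𝟎 | q-⊕ u s =
      solve 5 (λ a b p r t → con true :+ (((con true :+ a) :+ p) :+ ((con true :+ r) :+ con false)
                               :+ ((con true :+ b) :+ ((p :+ r) :+ t)))
                             := (a :+ b) :+ t)
        refl (isZero u) (isZero (u ⊕ s)) (q u) (q s) (μ ∧ ⟪ u , s ⟫)

    -- The pairing with s vanishes at 0 and at s, which are distinct, so at most one of the three
    -- terms is true and the sum modulo 2 is an ordinary sum. The form `u ⊕ 𝟎` matches `count-at`.
    disjoint : ∀ u → 𝟙 ((isZero u xor isZero (u ⊕ s)) xor (μ ∧ ⟪ u , s ⟫)) ≡
      (𝟙 (isZero (u ⊕ 𝟎)) + 𝟙 (isZero (u ⊕ s))) + 𝟙 (μ ∧ ⟪ u , s ⟫)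
    disjoint u rewrite ⊕-identityʳ u with isZero u in u≡𝟎 | isZero (u ⊕ s) in u≡s
    ... | false | false = refl
    ... | true  | true  = contradiction
      (trans (sym (⊕≡𝟎⇒≡ u s (isZero⇒≡𝟎 (u ⊕ s) u≡s))) (isZero⇒≡𝟎 u u≡𝟎)) s≢𝟎
    ... | true  | false rewrite isZero⇒≡𝟎 u u≡𝟎 | ⟪⟫-zeroˡ s | ∧-zeroʳ μ = refl
    ... | false | true  rewrite ⊕≡𝟎⇒≡ u s (isZero⇒≡𝟎 (u ⊕ s) u≡s) | ⟪⟫-self s | ∧-zeroʳ μ = refl

    neighboursAt-x₀ : neighboursAt C x₀ 1 ≡ 2 + count (λ i → μ ∧ ⟪ φ i , s ⟫)
    neighboursAt-x₀ = begin
      neighboursAt C x₀ 1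
        ≡⟨ length-filter-tabulate (λ i → dC C (flipAt x₀ i) ≡ᵇ 1) id ⟩
      count (λ i → dC C (flipAt x₀ i) ≡ᵇ 1)
        ≡⟨ Σℕ.sum-cong-≗ {suc n} (λ i → trans (cong 𝟙 (trans (near i) (f-derivative (φ i)))) (disjoint (φ i))) ⟩
      Σℕ.sum (λ i → (𝟙 (isZero (φ i ⊕ 𝟎)) + 𝟙 (isZero (φ i ⊕ s))) + 𝟙 (μ ∧ ⟪ φ i , s ⟫))
        ≡⟨ Σℕ.∑-distrib-+ (λ i → 𝟙 (isZero (φ i ⊕ 𝟎)) + 𝟙 (isZero (φ i ⊕ s))) (λ i → 𝟙 (μ ∧ ⟪ φ i , s ⟫)) ⟩
      Σℕ.sum (λ i → 𝟙 (isZero (φ i ⊕ 𝟎)) + 𝟙 (isZero (φ i ⊕ s))) + count (λ i → μ ∧ ⟪ φ i , s ⟫)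
        ≡⟨ cong (_+ count (λ i → μ ∧ ⟪ φ i , s ⟫)) (Σℕ.∑-distrib-+ (λ i → 𝟙 (isZero (φ i ⊕ 𝟎))) (λ i → 𝟙 (isZero (φ i ⊕ s)))) ⟩
      (count (λ i → isZero (φ i ⊕ 𝟎)) + count (λ i → isZero (φ i ⊕ s))) + count (λ i → μ ∧ ⟪ φ i , s ⟫)
        ≡⟨ cong (_+ count (λ i → μ ∧ ⟪ φ i , s ⟫)) (cong₂ _+_ (count-at 𝟎) (count-at s)) ⟩
      2 + count (λ i → μ ∧ ⟪ φ i , s ⟫) ∎
      where open ≡-Reasoning

    -- For μ = 1 the count is half of the length plus 2. For μ = 0 it is 2, while half of a length
    -- of at least 6 is at least 3.
    neighboursAt-x₀≢ : 6 ≤ suc n → (∃ λ w → ⟪ s , w ⟫ ≡ true) → neighboursAt C x₀ 1 ≢ suc n / 2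
    neighboursAt-x₀≢ 6≤N partner eq = by-cases μ refl
      where
      K≡ : ∀ b → μ ≡ b → 2 + count (λ i → b ∧ ⟪ φ i , s ⟫) ≡ suc n / 2
      K≡ b refl = trans (sym neighboursAt-x₀) eq
      by-cases : ∀ b → μ ≡ b → ⊥
      by-cases true μ≡ = m≢1+n+m (count (λ i → ⟪ φ i , s ⟫)) {1} (sym (trans (K≡ true μ≡)
        (trans (cong (_/ 2) (sym (count-hyperplane false s partner))) (m*n/n≡m (count (λ i → ⟪ φ i , s ⟫)) 2))))
      by-cases false μ≡ = <⇒≢ (≤-trans (s≤s (≤-refl {2})) (/-monoˡ-≤ 2 6≤N))
        (trans (cong (2 +_) (sym (count-none {suc n} (λ _ → refl)))) (K≡ false μ≡))

-- Powers of a primitive element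

head-mulα : ∀ {m} ps (v : Word (suc m)) → head (mulα (false ∷ ps) v) ≡ false
head-mulα ps (b ∷ v) with shiftIn b v
... | r , true  = refl
... | r , false = refl

shiftIn-𝟎 : ∀ {m} c (v : Word m) → shiftIn c v ≡ (𝟎 , false) → c ∷ v ≡ 𝟎
shiftIn-𝟎 c []      eq = cong (_∷ []) (cong proj₂ eq)
shiftIn-𝟎 c (b ∷ v) eq with shiftIn b v in eq′
... | r , o = cong₂ _∷_ (cong (head ∘ proj₁) eq)
  (shiftIn-𝟎 b v (trans eq′ (cong₂ _,_ (cong (tail ∘ proj₁) eq) (cong proj₂ eq))))

-- With constant coefficient 1, a carry makes the first entry of the product 1. A zero product
-- therefore comes from a shift without carry, which loses nothing.
mulα≡𝟎 : ∀ {m} ps (v : Word (suc m)) → mulα (true ∷ ps) v ≡ 𝟎 → v ≡ 𝟎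
mulα≡𝟎 ps (b ∷ v) eq with shiftIn b v in eq′
... | r , false = shiftIn-𝟎 b v (trans eq′ (cong (λ w → tail w , false) eq))

powα≢𝟎-unit : ∀ {m} ps i → powα {suc m} (true ∷ ps) i ≢ 𝟎
powα≢𝟎-unit ps (suc i) eq = powα≢𝟎-unit ps i (mulα≡𝟎 ps _ eq)

suc-len : ∀ m → suc (len m) ≡ 2 ^ m
suc-len m = m+[n∸m]≡n (m^n>0 2 m)

-- If the constant coefficient of p vanishes, then α, α², … all have first
-- coordinate 0, so too few vectors are available for them to be distinct.
constant-coefficient : ∀ m → 2 ≤ m → ∀ ps → ¬ IsPrimitive (suc m) (false ∷ ps)
constant-coefficient m 2≤m ps prim = collide (word-pigeonhole room (λ i → tail (powα (false ∷ ps) (suc (toℕ i)))))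
  where
  -- The exponents 1, ..., `L` are the positive ones below `len (suc m)`; exponent 0 is left out
  -- because `one` has first coordinate 1.
  L : ℕ
  L = len (suc m) ∸ 1
  1+L : suc L ≡ len (suc m)
  1+L = m+[n∸m]≡n {1} (≤-pred (≤-trans (^-monoʳ-≤ 2 {1} {suc m} (s≤s z≤n)) (≤-reflexive (sym (suc-len (suc m))))))
  room : 2 ^ m < L
  room = ≤-pred (≤-pred (begin
    suc (suc (suc (2 ^ m)))   ≤⟨ +-monoˡ-≤ (2 ^ m) {3} {4} (≤ᵇ⇒≤ 3 4 _) ⟩
    2 ^ 2 + 2 ^ m             ≤⟨ +-mono-≤ (^-monoʳ-≤ 2 2≤m) (≤-reflexive (sym (+-identityʳ (2 ^ m)))) ⟩
    2 ^ suc m                 ≡⟨ suc-len (suc m) ⟨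
    suc (len (suc m))         ≡⟨ cong suc 1+L ⟨
    suc (suc L)               ∎))
    where open ≤-Reasoning
  bound : (i : Fin L) → suc (toℕ i) < len (suc m)
  bound i = ≤-trans (s≤s (toℕ<n i)) (≤-reflexive 1+L)
  same-head : ∀ {k} (u v : Word (suc k)) → head u ≡ false → head v ≡ false → tail u ≡ tail v → u ≡ v
  same-head (_ ∷ _) (_ ∷ _) refl refl refl = refl
  collide : ¬ (∃ λ i → ∃ λ j → i F.< j × tail (powα (false ∷ ps) (suc (toℕ i))) ≡ tail (powα (false ∷ ps) (suc (toℕ j))))
  collide (i , j , i<j , eq) = <⇒≢ i<j (suc-injective (begin
    suc (toℕ i)                  ≡⟨ toℕ-fromℕ< (bound i) ⟨
    toℕ (F.fromℕ< (bound i))     ≡⟨ cong toℕ (prim _ _ (begin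
      powα (false ∷ ps) (toℕ (F.fromℕ< (bound i))) ≡⟨ cong (powα (false ∷ ps)) (toℕ-fromℕ< (bound i)) ⟩
      powα (false ∷ ps) (suc (toℕ i))              ≡⟨ same-head _ _ (head-mulα ps (powα (false ∷ ps) (toℕ i))) (head-mulα ps (powα (false ∷ ps) (toℕ j))) eq ⟩
      powα (false ∷ ps) (suc (toℕ j))              ≡⟨ cong (powα (false ∷ ps)) (toℕ-fromℕ< (bound j)) ⟨
      powα (false ∷ ps) (toℕ (F.fromℕ< (bound j))) ∎)) ⟩
    toℕ (F.fromℕ< (bound j))     ≡⟨ toℕ-fromℕ< (bound j) ⟩
    suc (toℕ j)                  ∎))
    where open ≡-Reasoning

-- Distinct powers alone do not exclude zero: for m = 2 and α² = 0 the powers 1, α, 0 are distinct.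
-- From m = 3 on, primitivity forces the constant coefficient 1, which makes multiplication by α
-- injective.
powα≢𝟎 : ∀ {m} → 3 ≤ m → (pc : Word m) → IsPrimitive m pc → ∀ i → powα pc i ≢ 𝟎
powα≢𝟎 {suc m} (s≤s 2≤m) (true ∷ ps)  prim i = powα≢𝟎-unit ps i
powα≢𝟎 {suc m} (s≤s 2≤m) (false ∷ ps) prim i = contradiction prim (constant-coefficient m 2≤m ps)

-- The coordinate ∞ of the extended code is matched with the zero vector.
position : ∀ {m} → Word m → Fin (suc (len m)) → Word m
position pc zero    = 𝟎
position pc (suc i) = hcol pc i

position-injective : ∀ {m} → 3 ≤ m → (pc : Word m) → IsPrimitive m pc →
  ∀ i j → position pc i ≡ position pc j → i ≡ j
position-injective 3≤m pc prim zero    zero    _  = refl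
position-injective 3≤m pc prim zero    (suc j) eq = contradiction (sym eq) (powα≢𝟎 3≤m pc prim (toℕ j))
position-injective 3≤m pc prim (suc i) zero    eq = contradiction eq (powα≢𝟎 3≤m pc prim (toℕ i))
position-injective 3≤m pc prim (suc i) (suc j) eq = cong suc (prim i j eq)

-- The parity check matrix of the extended code

∧-true⇒ : ∀ {a b} → a ∧ b ≡ true → a ≡ true × b ≡ true
∧-true⇒ {true} eq = refl , eq

all-true⇒ : ∀ {A : Set} {n} (p : A → Bool) (g : Fin n → A) →
  L.foldr _∧_ true (L.map p (L.tabulate g)) ≡ true → ∀ i → p (g i) ≡ true
all-true⇒ p g eq zero    = proj₁ (∧-true⇒ eq)
all-true⇒ p g eq (suc i) = all-true⇒ p (g ∘ suc) (proj₂ (∧-true⇒ {p (g zero)} eq)) i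

⇒all-true : ∀ {A : Set} {n} (p : A → Bool) (g : Fin n → A) → (∀ i → p (g i) ≡ true) →
  L.foldr _∧_ true (L.map p (L.tabulate g)) ≡ true
⇒all-true {n = zero}  p g eq = refl
⇒all-true {n = suc n} p g eq = cong₂ _∧_ (eq zero) (⇒all-true p (g ∘ suc) (eq ∘ suc))

not-true⇒ : ∀ {b} → not b ≡ true → b ≡ false
not-true⇒ {false} _ = refl

lookup-ext𝟎 : ∀ {k} (v : Word k) → (∀ i → lookup v i ≡ false) → v ≡ 𝟎
lookup-ext𝟎 []      _  = refl
lookup-ext𝟎 (b ∷ v) eq = cong₂ _∷_ (eq zero) (lookup-ext𝟎 v (eq ∘ suc))

dot-ones : ∀ {n} (x : Word n) → dot (tabulate λ _ → true) x ≡ parity x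
dot-ones []      = refl
dot-ones (b ∷ x) = cong (b xor_) (dot-ones x)

-- The coordinate ∞ enters only the overall parity check, so its column is 1 followed by zeros.
-- Placing it at the origin requires f to vanish there.
module ExtendedCode {m : ℕ} (pc : Word m) (i₁ i₂ : Fin 4) (f : Word m → Bool) (f-𝟎 : f 𝟎 ≡ false)
  (f-hcol : ∀ i → f (hcol pc i) ≡ (((wt (hcol pc i) % 4) ≡ᵇ toℕ i₁) ∨ ((wt (hcol pc i) % 4) ≡ᵇ toℕ i₂))) where

  h : Fin (suc (len m)) → Word (2 + m)
  h = column f ∘ position pc

  lookup₀ : ∀ b x → lookup (syn h (b ∷ x)) zero ≡ b xor parity x
  lookup₀ b x = trans (lookup-syn h (b ∷ x) zero) (cong (b xor_) (dot-ones x))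

  lookup₁ : ∀ b x → lookup (syn h (b ∷ x)) (suc zero) ≡ dot (vrow pc i₁ i₂) x
  lookup₁ b x = trans (lookup-syn h (b ∷ x) (suc zero))
    (cong₂ (λ a r → (a ∧ b) xor dot r x) f-𝟎 (tabulate-cong f-hcol))

  lookup₂ : ∀ b x k → lookup (syn h (b ∷ x)) (suc (suc k)) ≡ dot (Hrow pc k) x
  lookup₂ b x k = trans (lookup-syn h (b ∷ x) (suc (suc k)))
    (cong (λ a → (a ∧ b) xor dot (Hrow pc k) x) (lookup-replicate k false))

  codeword⇒ : ∀ x → extend (Cᵢ pc i₁ i₂) x ≡ true → syn h x ≡ 𝟎
  codeword⇒ (b ∷ x) eq = lookup-ext𝟎 (syn h (b ∷ x)) entry
    where
    entry : ∀ k → lookup (syn h (b ∷ x)) k ≡ false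
    entry zero          = trans (lookup₀ b x) (not-true⇒ (proj₂ (∧-true⇒ eq)))
    entry (suc zero)    = trans (lookup₁ b x) (not-true⇒ (proj₂ (∧-true⇒ {allRows pc x} (proj₁ (∧-true⇒ eq)))))
    entry (suc (suc k)) = trans (lookup₂ b x k) (not-true⇒
      (all-true⇒ (λ k → not (dot (Hrow pc k) x)) id (proj₁ (∧-true⇒ {allRows pc x} (proj₁ (∧-true⇒ eq)))) k))

  ⇒codeword : ∀ x → syn h x ≡ 𝟎 → extend (Cᵢ pc i₁ i₂) x ≡ true
  ⇒codeword (b ∷ x) eq = cong₂ _∧_
    (cong₂ _∧_
      (⇒all-true (λ k → not (dot (Hrow pc k) x)) id
        (λ k → cong not (trans (sym (lookup₂ b x k)) (entry (suc (suc k))))))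
      (cong not (trans (sym (lookup₁ b x)) (entry (suc zero)))))
    (cong not (trans (sym (lookup₀ b x)) (entry zero)))
    where
    entry : ∀ k → lookup (syn h (b ∷ x)) k ≡ false
    entry k = trans (cong (λ v → lookup v k) eq) (lookup-replicate k false)

-- Membership of the weight in a pair of residue classes modulo 4

indicator : Fin 4 → Fin 4 → Bool → Bool → Bool
indicator i₁ i₂ a b = (residue a b ≡ᵇ toℕ i₁) ∨ (residue a b ≡ᵇ toℕ i₂)

-- Exactly two of the four residues are selected, so the indicator has no
-- quadratic term in the two binary digits of the residue.
indicator-sum : ∀ i₁ i₂ → i₁ ≢ i₂ →
  (indicator i₁ i₂ false false xor indicator i₁ i₂ true false) xor
  (indicator i₁ i₂ false true xor indicator i₁ i₂ true true) ≡ false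
indicator-sum = from-yes (all? λ i₁ → all? λ i₂ → ¬? (i₁ F.≟ i₂) →-dec
  ((indicator i₁ i₂ false false xor indicator i₁ i₂ true false) xor
   (indicator i₁ i₂ false true xor indicator i₁ i₂ true true) B.≟ false))

-- As a polynomial in two bits, `g` has the sum of its four values as the coefficient of the product
-- ab; the hypothesis removes that term.
affine : (g : Bool → Bool → Bool) → (g false false xor g true false) xor (g false true xor g true true) ≡ false →
  ∀ a b → g a b ≡ g false false xor (((g false false xor g true false) ∧ a) xor ((g false false xor g false true) ∧ b))
affine g eq false false = solve 3 (λ x y z → x := x :+ ((x :+ y) :* con false :+ (x :+ z) :* con false)) refl
  (g false false) (g true false) (g false true)
affine g eq true  false = solve 3 (λ x y z → y := x :+ ((x :+ y) :* con true :+ (x :+ z) :* con false)) refl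
  (g false false) (g true false) (g false true)
affine g eq false true  = solve 3 (λ x y z → z := x :+ ((x :+ y) :* con false :+ (x :+ z) :* con true)) refl
  (g false false) (g true false) (g false true)
affine g eq true  true  = trans
  (solve 4 (λ x y z w → w := ((x :+ y) :+ (z :+ w)) :+ (x :+ ((x :+ y) :* con true :+ (x :+ z) :* con true))) refl
    (g false false) (g true false) (g false true) (g true true))
  (cong (_xor (g false false xor (((g false false xor g true false) ∧ true) xor ((g false false xor g false true) ∧ true)))) eq)

-- The quadratic form of the indicator, and the linear case

quadratic : ∀ {m} → Bool → Bool → Word m → Bool
quadratic l μ u = (l ∧ parity u) xor (μ ∧ e₂ u)

quadratic-⊕ : ∀ {m} l μ (u v : Word m) →
  quadratic l μ (u ⊕ v) ≡ (quadratic l μ u xor quadratic l μ v) xor (μ ∧ ⟪ u , v ⟫)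
quadratic-⊕ l μ u v rewrite parity-⊕ u v | e₂-⊕ u v =
  solve 7 (λ l μ p p′ e e′ b → l :* (p :+ p′) :+ μ :* ((e :+ e′) :+ b) :=
                                ((l :* p :+ μ :* e) :+ (l :* p′ :+ μ :* e′)) :+ μ :* b)
    refl l μ (parity u) (parity v) (e₂ u) (e₂ v) ⟪ u , v ⟫

quadratic-𝟎 : ∀ {m} l μ → quadratic l μ (𝟎 {m}) ≡ false
quadratic-𝟎 {m} l μ = cong₂ _xor_
  (trans (cong (l ∧_) (parity-𝟎 m)) (∧-zeroʳ l)) (trans (cong (μ ∧_) (e₂-𝟎 m)) (∧-zeroʳ μ))
  where
  e₂-𝟎 : ∀ m → e₂ (𝟎 {m}) ≡ false
  e₂-𝟎 zero    = refl
  e₂-𝟎 (suc m) = trans (xor-identityʳ _) (e₂-𝟎 m)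

-- For additive f the second check is a combination of the others, so m + 1 checks define a subset
-- of the code with at least 2^(n - m) words, twice the stated size.
linear-too-large : ∀ {n m} (p : Fin (suc n) → Word m) (f : Word m → Bool) →
  (∀ u v → f (u ⊕ v) ≡ f u xor f v) → (C : Code (suc n)) →
  (∀ x → syn (column f ∘ p) x ≡ 𝟎 → C x ≡ true) → suc m ≤ n → size C ≢ 2 ^ (n ∸ m ∸ 1)
linear-too-large {n} {m} p f linear C ⇒codeword m<n size≡ = 1+n≰n (^-cancelʳ-≤ {suc n} {n} (begin
  2 ^ suc n                                         ≤⟨ kernel-large h′ ⟩
  2 ^ suc m * count-words (isZero ∘ syn h′)         ≤⟨ *-monoʳ-≤ (2 ^ suc m) (count-words-mono kernel⊆C) ⟩
  2 ^ suc m * count-words C                         ≡⟨ cong (2 ^ suc m *_) (trans (sym (size≡count-words C)) size≡) ⟩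
  2 ^ suc m * 2 ^ (n ∸ m ∸ 1)                       ≡⟨ ^-distribˡ-+-* 2 (suc m) (n ∸ m ∸ 1) ⟨
  2 ^ (suc m + (n ∸ m ∸ 1))                         ≡⟨ cong (2 ^_) exponent ⟩
  2 ^ n                                             ∎))
  where
  open ≤-Reasoning
  ^-cancelʳ-≤ : ∀ {a b} → 2 ^ a ≤ 2 ^ b → a ≤ b
  ^-cancelʳ-≤ le = ≮⇒≥ (λ b<a → <⇒≱ (^-monoʳ-< 2 (s≤s (s≤s z≤n)) b<a) le)
  exponent : suc m + (n ∸ m ∸ 1) ≡ n
  exponent = trans (cong (suc m +_) (trans (∸-+-assoc n m 1) (cong (n ∸_) (+-comm m 1)))) (m+[n∸m]≡n m<n)
  h′ : Fin (suc n) → Word (suc m)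
  h′ i = true ∷ p i
  insert : Word (suc m) → Word (2 + m)
  insert (a ∷ s) = a ∷ f s ∷ s
  insert-⊕ : Additive insert
  insert-⊕ (a ∷ s) (b ∷ t) = cong (λ e → (a xor b) ∷ e ∷ s ⊕ t) (linear s t)
  kernel⊆C : ∀ x → isZero (syn h′ x) ≡ true → C x ≡ true
  kernel⊆C x eq = ⇒codeword x (trans (syn-additive insert-⊕ h′ x)
    (trans (cong insert (isZero⇒≡𝟎 _ eq)) (additive-𝟎 insert-⊕)))

-- The cases for c and μ

module _ (m : ℕ) (2∣m : 2 ∣ m) (4≤m : 4 ≤ m) (pc : Vec Bool m) (prim : IsPrimitive m pc)
  (i₁ i₂ : Fin 4) (i₁≢i₂ : i₁ ≢ i₂) where

  private
    C : Code (suc (len m))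
    C = extend (Cᵢ pc i₁ i₂)

    φ : Fin (suc (len m)) → Word m
    φ = position pc

    φ-injective : ∀ i j → φ i ≡ φ j → i ≡ j
    φ-injective = position-injective (≤-trans (n≤1+n 3) 4≤m) pc prim

    φ-surjective : ∀ v → ∃ λ i → φ i ≡ v
    φ-surjective = injective⇒surjective (sym (suc-len m)) φ φ-injective

    ψ : Word m → Fin (suc (len m))
    ψ = proj₁ ∘ φ-surjective

    φψ : ∀ u → φ (ψ u) ≡ u
    φψ = proj₂ ∘ φ-surjective

    ψφ : ∀ i → ψ (φ i) ≡ i
    ψφ i = φ-injective _ _ (φψ (φ i))

    hcol≢𝟎 : ∀ i → hcol pc i ≢ 𝟎
    hcol≢𝟎 i = powα≢𝟎 (≤-trans (n≤1+n 3) 4≤m) pc prim (toℕ i)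

    one≢𝟎 : powα pc 0 ≢ 𝟎
    one≢𝟎 = powα≢𝟎 (≤-trans (n≤1+n 3) 4≤m) pc prim 0

    nondegenerate : ∀ (v : Word m) → v ≢ 𝟎 → ∃ λ w → ⟪ v , w ⟫ ≡ true
    nondegenerate = ⟪⟫-nondegenerate (quotient 2∣m) (_∣_.equality 2∣m)

    c l μ : Bool
    c = indicator i₁ i₂ false false
    l = c xor indicator i₁ i₂ true false
    μ = c xor indicator i₁ i₂ false true

    row-entry : ∀ i → (((wt (hcol pc i) % 4) ≡ᵇ toℕ i₁) ∨ ((wt (hcol pc i) % 4) ≡ᵇ toℕ i₂)) ≡
      c xor quadratic l μ (hcol pc i)
    row-entry i = trans (cong (λ r → (r ≡ᵇ toℕ i₁) ∨ (r ≡ᵇ toℕ i₂)) (wt%4 (hcol pc i)))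
      (affine (indicator i₁ i₂) (indicator-sum i₁ i₂ i₁≢i₂) (parity (hcol pc i)) (e₂ (hcol pc i)))

    16≤N : 16 ≤ suc (len m)
    16≤N = ≤-trans (^-monoʳ-≤ 2 4≤m) (≤-reflexive (sym (suc-len m)))

    m<len : suc m ≤ len m
    m<len = ≤-pred (≤-trans (room m 4≤m) (≤-reflexive (sym (suc-len m))))
      where
      room : ∀ m → 4 ≤ m → 2 + m ≤ 2 ^ m
      room m 4≤m with m≤n⇒∃[o]m+o≡n 4≤m
      ... | k , refl = grow k
        where
        grow : ∀ k → 2 + (4 + k) ≤ 2 ^ (4 + k)
        grow zero    = ≤ᵇ⇒≤ 6 16 _
        grow (suc k) = ≤-trans (+-mono-≤ (m^n>0 2 (4 + k)) (grow k))
          (+-monoʳ-≤ (2 ^ (4 + k)) (≤-reflexive (sym (+-identityʳ _))))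

    Conclusion : Set
    Conclusion = CompletelyTransitive C × coveringRadius C ≡ 4 ×
      HasIntersectionArray C 4
        (suc (len m) ∷ len m ∷ suc (len m) / 2 ∷ 1 ∷ [])
        (1 ∷ suc (len m) / 2 ∷ len m ∷ suc (len m) ∷ [])

  altered : c ≡ true → ¬ Conclusion
  -- The array fails at its entry c₂, stored at index 1: `x₀` has distance 2 but the wrong number of
  -- neighbours at distance 1.
  altered c≡true (_ , _ , _ , _ , below) = neighboursAt-x₀≢ codeword⇒ ⇒codeword (≤-trans (≤ᵇ⇒≤ 6 16 _) 16≤N)
    (nondegenerate (powα pc 0) one≢𝟎) (below (x₀ codeword⇒ ⇒codeword) (suc zero) (dC-x₀ codeword⇒ ⇒codeword))
    where
    open Altered φ ψ φψ ψφ (quadratic l μ) μ (quadratic-⊕ l μ) (powα pc 0) one≢𝟎 C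
    f-𝟎′ : f 𝟎 ≡ false
    f-𝟎′ = cong₂ _xor_ (cong not (isZero-𝟎 m)) (quadratic-𝟎 {m} l μ)
    f-hcol : ∀ i → f (hcol pc i) ≡ (((wt (hcol pc i) % 4) ≡ᵇ toℕ i₁) ∨ ((wt (hcol pc i) % 4) ≡ᵇ toℕ i₂))
    f-hcol i = trans (cong (_xor quadratic l μ (hcol pc i)) (trans (cong not (isZero-false (hcol≢𝟎 i))) (sym c≡true)))
      (sym (row-entry i))
    open ExtendedCode pc i₁ i₂ f f-𝟎′ f-hcol using (codeword⇒; ⇒codeword)

  module _ (c≡false : c ≡ false) where

    private
      open module Code = ExtendedCode pc i₁ i₂ (quadratic l μ) (quadratic-𝟎 {m} l μ)
        (λ i → trans (cong (_xor quadratic l μ (hcol pc i)) (sym c≡false)) (sym (row-entry i)))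
        using (codeword⇒; ⇒codeword)

    linear : μ ≡ false → size C ≢ 2 ^ (len m ∸ m ∸ 1)
    linear μ≡false = linear-too-large φ (quadratic l μ) additive C ⇒codeword m<len
      where
      additive : ∀ u v → quadratic l μ (u ⊕ v) ≡ quadratic l μ u xor quadratic l μ v
      additive u v = trans (quadratic-⊕ l μ u v)
        (trans (cong (λ b → (quadratic l μ u xor quadratic l μ v) xor (b ∧ ⟪ u , v ⟫)) μ≡false) (xor-identityʳ _))

    bent : μ ≡ true → Conclusion
    bent μ≡true = completelyTransitive , coveringRadius≡ , hasIntersectionArray
      where
      polar : ∀ u v → quadratic l μ (u ⊕ v) ≡ (quadratic l μ u xor quadratic l μ v) xor ⟪ u , v ⟫
      polar u v = trans (quadratic-⊕ l μ u v)
        (cong (λ b → (quadratic l μ u xor quadratic l μ v) xor (b ∧ ⟪ u , v ⟫)) μ≡true)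
      open Bent φ ψ φψ ψφ (quadratic l μ) polar nondegenerate (powα pc 0) one≢𝟎 C codeword⇒ ⇒codeword

  characterization : size C ≡ 2 ^ (len m ∸ m ∸ 1) → Conclusion ⇔ (i₁ ≢ zero × i₂ ≢ zero)
  characterization size≡ = mk⇔ (forward c refl) (backward c μ refl refl)
    where
    forward : ∀ b → c ≡ b → Conclusion → i₁ ≢ zero × i₂ ≢ zero
    forward true  c≡ concl = contradiction concl (altered c≡)
    forward false c≡ _     = (λ { refl → contradiction c≡ λ () }) ,
      (λ { refl → contradiction (trans (sym (∨-zeroʳ (0 ≡ᵇ toℕ i₁))) c≡) λ () })
    c-false : ∀ i j → i ≢ zero → j ≢ zero → indicator i j false false ≡ false
    c-false zero    j       i≢0 _   = contradiction refl i≢0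
    c-false (suc i) zero    _   j≢0 = contradiction refl j≢0
    c-false (suc i) (suc j) _   _   = refl
    backward : ∀ b d → c ≡ b → μ ≡ d → i₁ ≢ zero × i₂ ≢ zero → Conclusion
    backward true  d     c≡ μ≡ (i₁≢0 , i₂≢0) = contradiction (trans (sym c≡) (c-false i₁ i₂ i₁≢0 i₂≢0)) λ ()
    -- Neither residue 0 nor 2 is selected, so the pair is {1, 3} and f is the parity; the size of
    -- the code rules this out.
    backward false false c≡ μ≡ _             = contradiction size≡ (linear c≡ μ≡)
    backward false true  c≡ μ≡ _             = bent c≡ μ≡

theorem2p7 : (m : ℕ) → 2 ∣ m → 4 ≤ m →
    (pc : Vec Bool m) → IsPrimitive m pc →
    (i₁ i₂ : Fin 4) → i₁ ≢ i₂ →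
    size (extend (Cᵢ pc i₁ i₂)) ≡ 2 ^ (len m ∸ m ∸ 1) →
    MinDist (extend (Cᵢ pc i₁ i₂)) 4 →
    ((CompletelyTransitive (extend (Cᵢ pc i₁ i₂)) ×
    coveringRadius (extend (Cᵢ pc i₁ i₂)) ≡ 4 ×
    HasIntersectionArray (extend (Cᵢ pc i₁ i₂)) 4
    (suc (len m) ∷ len m ∷ suc (len m) / 2 ∷ 1 ∷ [])
    (1 ∷ suc (len m) / 2 ∷ len m ∷ suc (len m) ∷ []))
    ⇔ (i₁ ≢ zero × i₂ ≢ zero))
theorem2p7 m 2∣m 4≤m pc prim i₁ i₂ i₁≢i₂ size≡ _ = characterization m 2∣m 4≤m pc prim i₁ i₂ i₁≢i₂ size≡
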